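{- Let $\alpha$ be a composition of $n$ and let $\mathscr D:=D(\mathcal V_\alpha,\mathrm w_{RB})$. (a) $C_{\mathcal V_\alpha}=\{\Sigma_L(P_{T^x}):T\in\mathsf{ST}(\mathscr D^x)\}$. Furthermore, $$\min C_{\mathcal V_\alpha}=[w_0(\mathrm{set}(\alpha)^c),\mathrm w_{RB}(\mathcal T'_\alpha)]_L\quad\text{and}\quad \max C_{\mathcal V_\alpha}=[\mathrm w_{RB1}(\mathcal T_\alpha),w_1([n-\ell(\alpha)])]_L .$$ (b) $(C_{\mathcal V_\alpha},\preceq)\cong(\mathsf{ST}(\mathscr D^x),\trianglelefteq)$ as posets.
   Context: Permutations. $n$ is a positive integer, $[n]=\{1,\dots,n\}$, $[0]=\emptyset$, $\mathfrak S_n$ the symmetric group (product = composition of maps; permutations written as words), $s_i=(i,i+1)$, $\ell(\sigma)$ Coxeter length, $w_0$ the longest element. $\mathrm{Des}_L(\sigma)=\{i:\ell(s_i\sigma)<\ell(\sigma)\}$, $\mathrm{Des}_R(\sigma)=\{i:\ell(\sigma s_i)<\ell(\sigma)\}$. $\preceq_L$ (resp. $\preceq_R$) has covers $\sigma\prec s_i\sigma$, $i\notin\mathrm{Des}_L(\sigma)$ (resp. $\sigma\prec\sigma s_i$, $i\notin\mathrm{Des}_R(\sigma)$); $[\sigma,\rho]_L$ is the interval for $\preceq_L$. For $S\subseteq[n-1]$, $S^{c}=[n-1]\setminus S$; $w_0(S)$ is the longest element of the subgroup generated by $\{s_i:i\in S\}$; $w_1(S)=w_0w_0(S^c)$ is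 the longest element of $\{z:\mathrm{Des}_R(z)\subseteq S\}$. For a composition $\alpha=(\alpha_1,\dots,\alpha_l)$ of $n$, $\ell(\alpha)=l$ and $\mathrm{set}(\alpha)=\{\alpha_1,\dots,\alpha_1+\dots+\alpha_{l-1}\}$. Classes. For nonempty left weak Bruhat intervals, $I_1\sim_D I_2$ iff there is a poset isomorphism $f:(I_1,\preceq_L)\to(I_2,\preceq_L)$ with $\mathrm{Des}_L(f(\gamma))=\mathrm{Des}_L(\gamma)$ for all $\gamma$. On a class $C$ put $[\sigma,\rho]_L\preceq[\sigma',\rho']_L$ iff $\sigma\preceq_R\sigma'$; it is known that $(C,\preceq)$ has a minimum and a maximum. Diagrams and fillings. Boxes are $(x,y)\in\mathbb Z_{>0}^2$ with $x$ = column from the left, $y$ = row from the bottom. For a diagram $D$ with $n$ boxes and no empty rows/columns, a standard filling is a bijection $F:D\to[n]$; $P_F$ is the poset on $[n]$ with $i\preceq j$ iff $x_i\le x_j$ and $y_i\le y_j$, where $(x_i,y_i)=F^{ -1}(i)$; $\Sigma_L(P)=\{\sigma\in\mathfrak S_n:\sigma(i)\le\sigma(j)\text{ whenever }i\preceq_Pj\}$. $\mathsf{ST}(D)$: standard fillings $T$ with $T(i,j)\le T(k,l)$ whenever $i\le k$, $j\le l$, ordered by $T\trianglelefteq U$ iff $\mathrm w_{TL}(T)\preceq_L\mathrm w_{TL}(U)$, where $\mathrm w_{TL}$ reads each column top to bottom, leftmost column first. $D^x$, $T^x$: reflection across the $x$-axis (shifted upward to the first quadrant, touching the axes). Tableaux.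 $\mathrm{tcd}(\alpha)=\{(j,i):1\le i\le\ell(\alpha),1\le j\le\alpha_i\}$. A standard immaculate tableau (SIT) of shape $\alpha$ is a bijective filling of $\mathrm{tcd}(\alpha)$ by $[n]$ with rows increasing left to right and first column increasing bottom to top. $\mathrm w_{RB}$ reads each row right to left, bottom row first. $\mathrm w_{RB1}$ first reads, in each row right to left, bottom row first, all entries not in the first column, and then the first column bottom to top. $\mathcal T_\alpha$ is the SIT filled with $1,\dots,n$ along rows left to right, bottom row first. $\mathcal T'_\alpha$ is the SIT with first column $1,\dots,\ell(\alpha)$ bottom to top and the remaining boxes filled with $\ell(\alpha)+1,\dots,n$ left to right along rows, top row first. $C_{\mathcal V_\alpha}$ is the $\sim_D$-class of $\{\mathrm w_{RB}(T):T\text{ an SIT of shape }\alpha\}$, which is known to be the interval $[w_0(\mathrm{set}(\alpha)^c),\mathrm w_{RB}(\mathcal T'_\alpha)]_L$ ($\mathcal V_\alpha$ is the $H_n(0)$-module on SITs whose quasisymmetric characteristic is the dual immaculate function). $D(\mathcal V_\alpha,\mathrm w_{RB})=\{(i,1):1\le i\le\ell(\alpha)\}\cup\{(i,j+k_i):1\le i\le\ell(\alpha),\,2\le j\le\alpha_i\}$, where $k_{\ell(\alpha)}=0$ and $k_i=\sum_{i<r\le\ell(\alpha)}(\alpha_r-1)$. -}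

module Defs where

open import Data.Nat using (ℕ; suc; pred; _+_; _∸_; _≤_; _<_)
open import Data.Nat.Properties using (∸-cancelˡ-≡; m≤n⇒m≤1+n; ≤-totalOrder)
open import Data.Fin as Fin using (Fin; toℕ; inject₁)
open import Data.Fin.Permutation using (Permutation′; _≈_; _⟨$⟩ʳ_; _∘ₚ_; id; transpose)
open import Data.List using (List; _++_; map; concatMap; foldr; length; lookup; take; drop; sum; upTo; allFin)
open import Data.List.Extrema ≤-totalOrder using (max; xs≤max)
open import Data.List.Membership.Propositional using () renaming (_∈_ to _∈ˡ_)
open import Data.List.Membership.Propositional.Properties using (∈-map⁺; ∈-map⁻)
open import Data.List.Relation.Unary.All as All using (All)
open import Data.Product using (Σ; ∃-syntax; _×_; _,_; proj₁; proj₂)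
open import Data.Sum using (_⊎_)
open import Function using (Inverse)
open import Level using (0ℓ)
open import Relation.Binary using (Rel; Setoid)
import Relation.Binary.Construct.On as On
open import Relation.Binary.Morphism.Structures using (IsOrderIsomorphism)
open import Relation.Binary.PropositionalEquality using (_≡_; sym; trans; cong; cong₂; setoid)
open import Relation.Nullary using (¬_)
open import Relation.Unary using (Pred; U; _∈_; _∉_; _≐_; ∁)

private variable
  m n : ℕ

------------------------------------------------------------------------
-- Permutations
--
-- The positive integer n is written suc m.  An element k of [n] is
-- represented by the i : Fin (suc m) with toℕ i = k - 1, and an element k
-- of [n-1] by the i : Fin m with toℕ i = k - 1.

-- Product = composition of maps, rightmost factor first (the library's
-- _∘ₚ_ composes in the opposite order).
infixr 9 _·_
_·_ : Permutation′ n → Permutation′ n → Permutation′ n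
σ · τ = τ ∘ₚ σ

s : Fin m → Permutation′ (suc m)
s i = transpose (inject₁ i) (Fin.suc i)

eval : List (Fin m) → Permutation′ (suc m)
eval = foldr (λ i σ → s i · σ) id

-- Coxeter length, as a functional relation: k is the least length of a
-- word in the simple transpositions that evaluates to σ.
_HasLength_ : Permutation′ (suc m) → ℕ → Set
σ HasLength k =
  (∃[ w ] (length w ≡ k × eval w ≈ σ)) × (∀ w → eval w ≈ σ → k ≤ length w)

_Shorter_ : Rel (Permutation′ (suc m)) 0ℓ
σ Shorter τ = ∃[ k ] ∃[ l ] (σ HasLength k × τ HasLength l × k < l)

DesL DesR : Permutation′ (suc m) → Pred (Fin m) 0ℓ
DesL σ i = (s i · σ) Shorter σ
DesR σ i = (σ · s i) Shorter σ

-- Weak orders: reflexive-transitive closures of the cover relations, up to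
-- pointwise equality of permutations.
infix 4 _⪯L_ _⪯R_
data _⪯L_ {m : ℕ} (σ τ : Permutation′ (suc m)) : Set where
  done : σ ≈ τ → σ ⪯L τ
  step : ∀ i → i ∉ DesL σ → (s i · σ) ⪯L τ → σ ⪯L τ

data _⪯R_ {m : ℕ} (σ τ : Permutation′ (suc m)) : Set where
  done : σ ≈ τ → σ ⪯R τ
  step : ∀ i → i ∉ DesR σ → (σ · s i) ⪯R τ → σ ⪯R τ

-- The subgroup generated by the s i with i ∈ S; inverses are not needed as
-- the generators are involutions.
⟨_⟩ : Pred (Fin m) 0ℓ → Pred (Permutation′ (suc m)) 0ℓ
⟨ S ⟩ σ = ∃[ w ] (All S w × eval w ≈ σ)

IsLongest : Pred (Permutation′ (suc m)) 0ℓ → Pred (Permutation′ (suc m)) 0ℓ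
IsLongest A σ =
  σ ∈ A × ∃[ k ] (σ HasLength k × (∀ τ l → τ ∈ A → τ HasLength l → l ≤ k))

Is-w₀ : Pred (Permutation′ (suc m)) 0ℓ
Is-w₀ = IsLongest U

Is-w₀⟨_⟩ : Pred (Fin m) 0ℓ → Pred (Permutation′ (suc m)) 0ℓ
Is-w₀⟨ S ⟩ = IsLongest ⟨ S ⟩

Is-w₁⟨_⟩ : Pred (Fin m) 0ℓ → Pred (Permutation′ (suc m)) 0ℓ
Is-w₁⟨ S ⟩ σ = ∃[ u ] ∃[ v ] (Is-w₀ u × Is-w₀⟨ ∁ S ⟩ v × σ ≈ u · v)

------------------------------------------------------------------------
-- Nonempty left weak Bruhat intervals and their classes

record Interval (m : ℕ) : Set where
  field
    lo hi : Permutation′ (suc m)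
    lo⪯hi : lo ⪯L hi

open Interval public

⟦_⟧ : Interval m → Pred (Permutation′ (suc m)) 0ℓ
⟦ I ⟧ γ = lo I ⪯L γ × γ ⪯L hi I

-- Stated for arbitrary sets of permutations, so that it applies to sets
-- that are intervals without being presented by their endpoints.
infix 4 _∼D_
_∼D_ : Rel (Pred (Permutation′ (suc m)) 0ℓ) 0ℓ
A ∼D B = ∃[ f ]
  ( IsOrderIsomorphism {A = Σ _ A} {B = Σ _ B}
      (λ γ δ → proj₁ γ ≈ proj₁ δ) (λ γ δ → proj₁ γ ≈ proj₁ δ)
      (λ γ δ → proj₁ γ ⪯L proj₁ δ) (λ γ δ → proj₁ γ ⪯L proj₁ δ)
      f
  × (∀ γ → DesL (proj₁ (f γ)) ≐ DesL (proj₁ γ)))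

infix 4 _⪯_
_⪯_ : Rel (Interval m) 0ℓ
I ⪯ J = lo I ⪯R lo J

IsMin IsMax : Pred (Interval m) 0ℓ → Pred (Interval m) 0ℓ
IsMin C I = I ∈ C × (∀ J → J ∈ C → I ⪯ J)
IsMax C I = I ∈ C × (∀ J → J ∈ C → J ⪯ I)

------------------------------------------------------------------------
-- Diagrams and fillings

Box : Set
Box = ℕ × ℕ

col row : Box → ℕ
col = proj₁
row = proj₂

-- Only membership matters: order and multiplicity in the list are
-- irrelevant, because cells are compared by their coordinates.
Diagram : Set
Diagram = List Box

Cell : Diagram → Set
Cell D = ∃[ b ] b ∈ˡ D

Cells : Diagram → Setoid 0ℓ 0ℓ
Cells D = On.setoid {B = Cell D} (setoid Box) proj₁

Filling : Diagram → ℕ → Set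
Filling D n = Inverse (Cells D) (setoid (Fin n))

entry : {D : Diagram} → Filling D n → Cell D → Fin n
entry = Inverse.to

position : {D : Diagram} → Filling D n → Fin n → Box
position F i = proj₁ (Inverse.from F i)

infix 4 _≤ᵇ_
_≤ᵇ_ : Rel Box 0ℓ
b ≤ᵇ c = col b ≤ col c × row b ≤ row c

-- The order of the poset P_F on [n].
P : {D : Diagram} → Filling D n → Rel (Fin n) 0ℓ
P F i j = position F i ≤ᵇ position F j

ΣL : Rel (Fin n) 0ℓ → Pred (Permutation′ n) 0ℓ
ΣL _≼_ σ = ∀ i j → i ≼ j → (σ ⟨$⟩ʳ i) Fin.≤ (σ ⟨$⟩ʳ j)

IsStandard : {D : Diagram} → Pred (Filling D n) 0ℓ
IsStandard {D = D} T = ∀ (b c : Cell D) → proj₁ b ≤ᵇ proj₁ c → entry T b Fin.≤ entry T c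

ST : Diagram → ℕ → Set
ST D n = Σ (Filling D n) IsStandard

infix 4 _≈ST_
_≈ST_ : {D : Diagram} → Rel (ST D n) 0ℓ
_≈ST_ {D = D} (T , _) (U , _) = ∀ (c : Cell D) → entry T c ≡ entry U c

height : Diagram → ℕ
height D = max 0 (map row D)

flipBox : ℕ → Box → Box
flipBox h (x , y) = (x , suc h ∸ y)

infixl 8 _^x
_^x : Diagram → Diagram
D ^x = map (flipBox (height D)) D

row≤height : (D : Diagram) {b : Box} → b ∈ˡ D → row b ≤ height D
row≤height D b∈D = All.lookup (xs≤max 0 (map row D)) (∈-map⁺ row b∈D)

flipBox-injective : ∀ h {b c} → row b ≤ h → row c ≤ h →
                    flipBox h b ≡ flipBox h c → b ≡ c
flipBox-injective h b≤h c≤h eq =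
  cong₂ _,_ (cong col eq)
            (∸-cancelˡ-≡ (m≤n⇒m≤1+n b≤h) (m≤n⇒m≤1+n c≤h) (cong row eq))

flipCell : {D : Diagram} → Cell D → Cell (D ^x)
flipCell {D} (b , b∈D) = flipBox (height D) b , ∈-map⁺ (flipBox (height D)) b∈D

unflipCell : {D : Diagram} → Cell (D ^x) → Cell D
unflipCell {D} (c , c∈) with b , b∈D , _ ← ∈-map⁻ (flipBox (height D)) c∈ = b , b∈D

flip-unflip : {D : Diagram} (c : Cell (D ^x)) →
              proj₁ (flipCell {D} (unflipCell {D} c)) ≡ proj₁ c
flip-unflip {D} (c , c∈) with _ , _ , eq ← ∈-map⁻ (flipBox (height D)) c∈ = sym eq

flipCell-injective : {D : Diagram} (b c : Cell D) →
  proj₁ (flipCell {D} b) ≡ proj₁ (flipCell {D} c) → proj₁ b ≡ proj₁ c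
flipCell-injective {D} (b , b∈) (c , c∈) =
  flipBox-injective (height D) (row≤height D b∈) (row≤height D c∈)

unflipCell-cong : {D : Diagram} (c d : Cell (D ^x)) →
  proj₁ c ≡ proj₁ d → proj₁ (unflipCell {D} c) ≡ proj₁ (unflipCell {D} d)
unflipCell-cong {D} c d eq = flipCell-injective {D} (unflipCell {D} c) (unflipCell {D} d)
  (trans (flip-unflip {D} c) (trans eq (sym (flip-unflip {D} d))))

-- T ↦ T^x: the entry of a box of D is moved to the reflected box of D ^x.
reflect : {D : Diagram} → Filling D n → Filling (D ^x) n
reflect {D = D} T = record
  { to        = λ c → T.to (unflipCell {D} c)
  ; from      = λ i → flipCell {D} (T.from i)
  ; to-cong   = λ {c} {d} eq → T.to-cong (unflipCell-cong {D} c d eq)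
  ; from-cong = λ eq → cong (flipBox (height D)) (T.from-cong eq)
  ; inverse   =
      (λ {i} {c} eq → T.inverseˡ (flipCell-injective {D} (unflipCell {D} c) (T.from i)
                        (trans (flip-unflip {D} c) eq)))
    , (λ {c} {i} eq → trans (cong (flipBox (height D)) (T.inverseʳ eq))
                            (flip-unflip {D} c))
  }
  where module T = Inverse T

------------------------------------------------------------------------
-- Reading words
--
-- A reading is given by the relation "box b is read before box c".  The
-- word σ reads F along it iff the letters σ(1), σ(2), … of σ, taken in this
-- order, occupy boxes of F in reading order.  All the relations below are
-- strict total orders on the boxes concerned, so each filling has exactly
-- one reading word.

Reads : {D : Diagram} → Rel Box 0ℓ → Filling D n → Pred (Permutation′ n) 0ℓ
Reads _≺_ F σ = ∀ p q → p Fin.< q → position F (σ ⟨$⟩ʳ p) ≺ position F (σ ⟨$⟩ʳ q)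

-- F is filled with 1, 2, …, n along the given order of the boxes.
FilledAlong : {D : Diagram} → Rel Box 0ℓ → Pred (Filling D n) 0ℓ
FilledAlong _≺_ F = ∀ i j → i Fin.< j → position F i ≺ position F j

InFirstColumn : Pred Box 0ℓ
InFirstColumn b = col b ≡ 1

-- Columns from left to right, each from top to bottom.
TL : Rel Box 0ℓ
TL b c = col b < col c ⊎ (col b ≡ col c × row c < row b)

-- Rows from bottom to top, each from right to left.
RB : Rel Box 0ℓ
RB b c = row b < row c ⊎ (row b ≡ row c × col c < col b)

-- Off the first column along RB, then the first column from bottom to top.
RB1 : Rel Box 0ℓ
RB1 b c = (¬ InFirstColumn b × ¬ InFirstColumn c × RB b c)
        ⊎ (¬ InFirstColumn b × InFirstColumn c)
        ⊎ (InFirstColumn b × InFirstColumn c × row b < row c)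

-- Rows from bottom to top, each from left to right.
LB : Rel Box 0ℓ
LB b c = row b < row c ⊎ (row b ≡ row c × col b < col c)

-- First column from bottom to top, then the other boxes row by row from the
-- top row down, each row from left to right.
FirstColumnThenLT : Rel Box 0ℓ
FirstColumnThenLT b c =
    (InFirstColumn b × InFirstColumn c × row b < row c)
  ⊎ (InFirstColumn b × ¬ InFirstColumn c)
  ⊎ (¬ InFirstColumn b × ¬ InFirstColumn c
      × (row c < row b ⊎ (row b ≡ row c × col b < col c)))

infix 4 _⊴_
_⊴_ : {D : Diagram} → Rel (ST D (suc m)) 0ℓ
(T , _) ⊴ (U , _) = ∃[ σ ] ∃[ τ ] (Reads TL T σ × Reads TL U τ × σ ⪯L τ)

------------------------------------------------------------------------
-- Compositions and standard immaculate tableaux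

record Composition (n : ℕ) : Set where
  field
    parts    : List ℕ
    positive : All (1 ≤_) parts
    sums     : sum parts ≡ n

open Composition public

ℓ : Composition n → ℕ
ℓ α = length (parts α)

part : (α : Composition n) → Fin (ℓ α) → ℕ
part α = lookup (parts α)

setOf : Composition (suc m) → Pred (Fin m) 0ℓ
setOf α i = ∃[ k ] (1 ≤ k × k < ℓ α × suc (toℕ i) ≡ sum (take k (parts α)))

-- The subset [k] ∩ [n-1] of [n-1].
upToSet : ℕ → Pred (Fin m) 0ℓ
upToSet k i = suc (toℕ i) ≤ k

-- a, a + 1, …, b.
range : ℕ → ℕ → List ℕ
range a b = map (a +_) (upTo (suc b ∸ a))

tcd : Composition n → Diagram
tcd α = concatMap (λ i → map (λ j → (j , suc (toℕ i))) (range 1 (part α i))) (allFin (ℓ α))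

IsImmaculate : (α : Composition n) → Pred (Filling (tcd α) n) 0ℓ
IsImmaculate α T =
    (∀ (b c : Cell (tcd α)) → row (proj₁ b) ≡ row (proj₁ c) → col (proj₁ b) < col (proj₁ c) →
       entry T b Fin.< entry T c)
  × (∀ (b c : Cell (tcd α)) → InFirstColumn (proj₁ b) → InFirstColumn (proj₁ c) →
       row (proj₁ b) < row (proj₁ c) → entry T b Fin.< entry T c)

SIT : Composition n → Set
SIT {n} α = Σ (Filling (tcd α) n) (IsImmaculate α)

Is-𝒯 Is-𝒯′ : (α : Composition n) → Pred (SIT α) 0ℓ
Is-𝒯  α (T , _) = FilledAlong LB T
Is-𝒯′ α (T , _) = FilledAlong FirstColumnThenLT T

readingWords : (α : Composition n) → Pred (Permutation′ n) 0ℓ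
readingWords α σ = Σ (SIT α) λ T → Reads RB (proj₁ T) σ

-- The ∼D-class, among intervals, of the set of reading words of SITs.
C𝒱 : Composition (suc m) → Pred (Interval m) 0ℓ
C𝒱 α I = ⟦ I ⟧ ∼D readingWords α

shift : (α : Composition n) → Fin (ℓ α) → ℕ
shift α i = sum (map pred (drop (suc (toℕ i)) (parts α)))

𝒟 : Composition n → Diagram
𝒟 α = map (λ i → (suc (toℕ i) , 1)) (allFin (ℓ α))
   ++ concatMap (λ i → map (λ j → (suc (toℕ i) , j + shift α i)) (range 2 (part α i)))
                (allFin (ℓ α))

{-# OPTIONS --safe #-}
module Submission where

-- Number the boxes of tcd(α) row by row, so that 𝒯 becomes the identity.  The
-- diagrams 𝒟 and 𝒟^x then give two orders on the same cells: the SITs are the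
-- linear extensions T of the first, the fillings in ST(𝒟^x) are the linear
-- extensions F of the second, and Σ_L(P_{F^x}) consists of the words T F⁻¹ that
-- read the SITs in the order F.  Comparing inversions, this set is the interval
-- [F⁻¹, 𝒯′F⁻¹]_L.  Two fillings F and G can disagree only on pairs that are
-- comparable in 𝒟 without being covers; such pairs never carry consecutive
-- entries, so T F⁻¹ ↦ T G⁻¹ preserves descents and left weak order.
--
-- Conversely, a descent-preserving isomorphism f sends the cover γ ≺ s_i γ to a
-- cover f(γ) ≺ s_j f(γ), and i is a descent of s_j f(γ) but not of f(γ), which
-- forces j = i.  Hence f is a right translation.  With F = (lo I)⁻¹, standardness
-- of F follows from lo I ⪯ hi I for cells that are incomparable in 𝒟, from the
-- descents of lo I within a row, and from those of hi I in the first column.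
-- Finally w_TL reads F back as a permutation, so ⊴ compares the F = (lo I)⁻¹ in
-- left weak order, which is ⪯R on the lo I.
open import Defs
open import Data.Nat using (ℕ; suc; _∸_)
open import Data.Product using (Σ; _×_; proj₁)
open import Relation.Unary using (_∈_; _≐_; ∁)
open import Relation.Binary.Morphism.Structures using (IsOrderIsomorphism)

open import Data.Empty using (⊥-elim)
open import Data.Fin as Fin using (Fin; zero; suc; toℕ; inject₁; combine; remQuot; punchOut)
open import Data.Fin.Permutation
  using (Permutation′; _≈_; _⟨$⟩ʳ_; _⟨$⟩ˡ_; permutation; id; flip; inverseˡ; inverseʳ)
open import Data.Fin.Permutation.Components using (transpose)
open import Data.Fin.Properties as Fin
  using (any?; toℕ-inject₁; toℕ-injective; remQuot-combine; punchOut-injective; injective⇒≤)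
open import Data.Fin.Subset as Subset using (Subset; ∣_∣; inside; outside)
open import Data.Fin.Subset.Properties
  using (∈⊤; ∣⊤∣≡n; ∣⊥∣≡0; ∣∁p∣≡n∸∣p∣; p⊆q⇒∣p∣≤∣q∣; p⊂q⇒∣p∣<∣q∣; p─q⊆p; x∈p∧x≢y⇒x∈p-y;
         x∈p⇒∣p-x∣<∣p∣; x∉p⇒x∈∁p; x∈∁p⇒x∉p; ⊆-antisym)
open import Data.List
  using (List; []; _∷_; _++_; [_]; length; reverse; map; concatMap; take; drop; lookup; allFin)
open import Data.List.Membership.Propositional using (lose; find) renaming (_∈_ to _∈ˡ_)
open import Data.List.Membership.Propositional.Properties
  using (∈-map⁺; ∈-map⁻; ∈-++⁺ˡ; ∈-++⁺ʳ; ∈-++⁻; ∈-concatMap⁺; ∈-concatMap⁻; ∈-upTo⁺; ∈-upTo⁻; ∈-allFin; ∈-lookup)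
open import Data.List.Properties using (length-++; length-reverse; unfold-reverse)
open import Data.List.Relation.Unary.All as All using (All; []; _∷_)
import Data.List.Relation.Unary.All.Properties as All
import Data.List.Relation.Unary.Any.Properties as Any
open import Data.Nat as ℕ using (zero; pred; _+_; _*_; _⊓_; _≤_; _<_; s≤s; z≤n)
open import Data.Nat.ListAction using (sum)
import Data.Nat.Properties as ℕ
open import Data.Product using (∃-syntax; _,_; proj₂; uncurry)
open import Data.Sum using (_⊎_; inj₁; inj₂)
open import Data.Vec using (tabulate; _∷_; here; there)
open import Data.Vec.Properties using (lookup∘tabulate; []=⇒lookup; lookup⇒[]=)
open import Function using (_∘_; Inverse)
open import Level using (0ℓ)
open import Relation.Binary.Definitions using (Tri; tri<; tri≈; tri>)
open import Relation.Binary.PropositionalEquality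
  using (_≡_; _≢_; refl; sym; trans; cong; cong₂; subst; subst₂; module ≡-Reasoning)
open import Relation.Nullary using (¬_; Dec; yes; no; does; contradiction)
open import Relation.Nullary.Decidable using (_×-dec_; _⊎-dec_; ¬?; dec-true)
open import Relation.Unary using (Pred; Decidable; _∉_)

-- The definitions speak of shortest words and covers, so a translation comes first: Coxeter length
-- becomes the number of inversions, `⪯L` becomes inclusion `⊑` of sets of inverted positions, and
-- `⪯R` becomes the same inclusion for inverses. Claims about intervals then turn into claims about
-- single pairs of cells. Recovering standardness of `F` from an abstract isomorphism is the
-- delicate point, because descents only see consecutive entries. Each kind of pair therefore needs
-- its own witness. The cells of a row carry consecutive entries in 𝒯, so the least element decides
-- them. The first column carries consecutive entries in 𝒯′ but in general not in 𝒯, so the greatest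
-- element decides it. Cells incomparable in 𝒟 need not be consecutive anywhere, but 𝒯 and 𝒯′ order
-- them oppositely, and `lo I ⪯L hi I` allows inversions to appear, never to disappear.

private variable
  m n : ℕ

-- Permutations as bijections

to-injective : (σ : Permutation′ n) {p q : Fin n} → σ ⟨$⟩ʳ p ≡ σ ⟨$⟩ʳ q → p ≡ q
to-injective σ eq = trans (sym (inverseˡ σ)) (trans (cong (σ ⟨$⟩ˡ_) eq) (inverseˡ σ))

≈-sym : {σ τ : Permutation′ n} → σ ≈ τ → τ ≈ σ
≈-sym eq i = sym (eq i)

≈-trans : {σ τ υ : Permutation′ n} → σ ≈ τ → τ ≈ υ → σ ≈ υ
≈-trans eq eq′ i = trans (eq i) (eq′ i)

from-unique : (σ : Permutation′ n) {p v : Fin n} → σ ⟨$⟩ʳ p ≡ v → σ ⟨$⟩ˡ v ≡ p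
from-unique σ eq = trans (cong (σ ⟨$⟩ˡ_) (sym eq)) (inverseˡ σ)

to-unique : (σ : Permutation′ n) {p v : Fin n} → σ ⟨$⟩ˡ v ≡ p → σ ⟨$⟩ʳ p ≡ v
to-unique σ eq = trans (cong (σ ⟨$⟩ʳ_) (sym eq)) (inverseʳ σ)

flip-cong : {σ τ : Permutation′ n} → σ ≈ τ → flip σ ≈ flip τ
flip-cong {σ = σ} {τ} eq v = from-unique σ (trans (eq _) (inverseʳ τ))

-- Subsets of Fin n

subsetOf : {P : Pred (Fin n) 0ℓ} → Decidable P → Subset n
subsetOf P? = tabulate (does ∘ P?)

∈subsetOf⁺ : {P : Pred (Fin n) 0ℓ} (P? : Decidable P) {i : Fin n} → P i → i Subset.∈ subsetOf P?
∈subsetOf⁺ P? {i} Pi = lookup⇒[]= i _ (trans (lookup∘tabulate _ i) (dec-true (P? i) Pi))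

∈subsetOf⁻ : {P : Pred (Fin n) 0ℓ} (P? : Decidable P) {i : Fin n} → i Subset.∈ subsetOf P? → P i
∈subsetOf⁻ P? {i} i∈ with P? i | trans (sym (lookup∘tabulate (does ∘ P?) i)) ([]=⇒lookup i∈)
... | yes Pi | _ = Pi

-- Used to show that a simple transposition creates at most one inversion. At the position `x` the
-- heads are unconstrained and cost at most one; elsewhere a head in `q` is also in `p`.
∣∣-insert : (p q : Subset n) (x : Fin n) → (∀ {y} → y Subset.∈ q → y Subset.∈ p ⊎ y ≡ x) →
            ∣ q ∣ ≤ suc ∣ p ∣
∣∣-insert (a ∷ p) (b ∷ q) zero q⊆ = ℕ.≤-trans (head-≤ b) (s≤s (ℕ.≤-trans (p⊆q⇒∣p∣≤∣q∣ tail⊆) (tail-≤ a)))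
  where
  head-≤ : ∀ b → ∣ b ∷ q ∣ ≤ suc ∣ q ∣
  head-≤ inside = ℕ.≤-refl
  head-≤ outside = ℕ.n≤1+n _
  tail-≤ : ∀ a → ∣ p ∣ ≤ ∣ a ∷ p ∣
  tail-≤ inside = ℕ.n≤1+n _
  tail-≤ outside = ℕ.≤-refl
  tail⊆ : q Subset.⊆ p
  tail⊆ y∈ with q⊆ (there y∈)
  ... | inj₁ (there y∈p) = y∈p
∣∣-insert (a ∷ p) (b ∷ q) (suc x) q⊆ = cons a b head⊆ (∣∣-insert p q x tail⊆)
  where
  tail⊆ : ∀ {y} → y Subset.∈ q → y Subset.∈ p ⊎ y ≡ x
  tail⊆ y∈ with q⊆ (there y∈)
  ... | inj₁ (there y∈p) = inj₁ y∈p
  ... | inj₂ refl = inj₂ refl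
  head⊆ : b ≡ inside → a ≡ inside
  head⊆ refl with q⊆ here
  ... | inj₁ here = refl
  cons : ∀ a b → (b ≡ inside → a ≡ inside) → ∣ q ∣ ≤ suc ∣ p ∣ → ∣ b ∷ q ∣ ≤ suc ∣ a ∷ p ∣
  cons inside inside _ le = s≤s le
  cons inside outside _ le = ℕ.m≤n⇒m≤1+n le
  cons outside inside b⇒a _ with () ← b⇒a refl
  cons outside outside _ le = le

-- Simple transpositions

lower upper : Fin m → Fin (suc m)
lower = inject₁
upper = suc

lower<upper : (i : Fin m) → lower i Fin.< upper i
lower<upper i = s≤s (ℕ.≤-reflexive (toℕ-inject₁ i))

transpose-fst : (i j : Fin n) → transpose i j i ≡ j
transpose-fst i j with i Fin.≟ i
... | yes _ = refl
... | no ≢ = contradiction refl ≢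

transpose-snd : (i j : Fin n) → transpose i j j ≡ i
transpose-snd i j with j Fin.≟ i
... | yes eq = eq
... | no _ with j Fin.≟ j
...   | yes _ = refl
...   | no ≢ = contradiction refl ≢

transpose-other : (i j : Fin n) {k : Fin n} → k ≢ i → k ≢ j → transpose i j k ≡ k
transpose-other i j {k} ≢i ≢j with k Fin.≟ i
... | yes eq = contradiction eq ≢i
... | no _ with k Fin.≟ j
...   | yes eq = contradiction eq ≢j
...   | no _ = refl

s-lower : (i : Fin m) → s i ⟨$⟩ʳ lower i ≡ upper i
s-lower i = transpose-fst (lower i) (upper i)

s-upper : (i : Fin m) → s i ⟨$⟩ʳ upper i ≡ lower i
s-upper i = transpose-snd (lower i) (upper i)

s-other : (i : Fin m) {k : Fin (suc m)} → k ≢ lower i → k ≢ upper i → s i ⟨$⟩ʳ k ≡ k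
s-other i = transpose-other (lower i) (upper i)

data SwapView (i : Fin m) : Fin (suc m) → Fin (suc m) → Set where
  is-lower : SwapView i (lower i) (upper i)
  is-upper : SwapView i (upper i) (lower i)
  is-other : ∀ {k} → k ≢ lower i → k ≢ upper i → SwapView i k k

swapView : (i : Fin m) (k : Fin (suc m)) → SwapView i k (s i ⟨$⟩ʳ k)
swapView i k = go (k Fin.≟ lower i) (k Fin.≟ upper i)
  where
  go : Dec (k ≡ lower i) → Dec (k ≡ upper i) → SwapView i k (s i ⟨$⟩ʳ k)
  go (yes refl) _ = subst (SwapView i k) (sym (s-lower i)) is-lower
  go (no _) (yes refl) = subst (SwapView i k) (sym (s-upper i)) is-upper
  go (no ≢l) (no ≢u) = subst (SwapView i k) (sym (s-other i ≢l ≢u)) (is-other ≢l ≢u)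

s-involutive : (i : Fin m) (k : Fin (suc m)) → s i ⟨$⟩ʳ (s i ⟨$⟩ʳ k) ≡ k
s-involutive i k with s i ⟨$⟩ʳ k | swapView i k
... | _ | is-lower = s-upper i
... | _ | is-upper = s-lower i
... | _ | is-other ≢l ≢u = s-other i ≢l ≢u

s-from : (i : Fin m) (k : Fin (suc m)) → s i ⟨$⟩ˡ k ≡ s i ⟨$⟩ʳ k
s-from i k = from-unique (s i) (s-involutive i k)

lower<⇒upper≤ : (i : Fin m) {k : Fin (suc m)} → lower i Fin.< k → upper i Fin.≤ k
lower<⇒upper≤ i {k} l<k = subst (λ x → suc x ≤ toℕ k) (toℕ-inject₁ i) l<k

<upper⇒≤lower : (i : Fin m) {k : Fin (suc m)} → k Fin.< upper i → k Fin.≤ lower i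
<upper⇒≤lower i {k} (s≤s k≤i) = subst (toℕ k ≤_) (sym (toℕ-inject₁ i)) k≤i

-- The two values exchanged are adjacent, so every third value compares in the same way with both;
-- only the exchanged pair itself changes order.
s-mono : (i : Fin m) {a b : Fin (suc m)} → a Fin.< b →
         (s i ⟨$⟩ʳ a) Fin.< (s i ⟨$⟩ʳ b) ⊎ (a ≡ lower i × b ≡ upper i)
s-mono i {a} {b} a<b with s i ⟨$⟩ʳ a | swapView i a | s i ⟨$⟩ʳ b | swapView i b
... | _ | is-lower | _ | is-lower = contradiction a<b (ℕ.<-irrefl refl)
... | _ | is-lower | _ | is-upper = inj₂ (refl , refl)
... | _ | is-lower | _ | is-other _ ≢u = inj₁ (Fin.≤∧≢⇒< (lower<⇒upper≤ i a<b) (≢u ∘ sym))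
... | _ | is-upper | _ | is-lower = contradiction a<b (ℕ.<-asym (lower<upper i))
... | _ | is-upper | _ | is-upper = contradiction a<b (ℕ.<-irrefl refl)
... | _ | is-upper | _ | is-other _ _ = inj₁ (ℕ.<-trans (lower<upper i) a<b)
... | _ | is-other _ _ | _ | is-lower = inj₁ (ℕ.<-trans a<b (lower<upper i))
... | _ | is-other ≢l _ | _ | is-upper = inj₁ (Fin.≤∧≢⇒< (<upper⇒≤lower i a<b) ≢l)
... | _ | is-other _ _ | _ | is-other _ _ = inj₁ a<b

-- Inversions and length

-- Pairs of positions, not of values: left multiplication acts on values, so these are the sets
-- whose inclusion is `⪯L`.
Inv : Permutation′ n → Fin n → Fin n → Set
Inv σ p q = p Fin.< q × (σ ⟨$⟩ʳ q) Fin.< (σ ⟨$⟩ʳ p)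

infix 4 _⊑_
_⊑_ : Permutation′ n → Permutation′ n → Set
σ ⊑ τ = ∀ {p q} → Inv σ p q → Inv τ p q

≈⇒⊑ : {σ τ : Permutation′ n} → σ ≈ τ → σ ⊑ τ
≈⇒⊑ eq (p<q , lt) = p<q , subst₂ Fin._<_ (eq _) (eq _) lt

inv? : (σ : Permutation′ n) → ∀ p q → Dec (Inv σ p q)
inv? σ p q = (p Fin.<? q) ×-dec ((σ ⟨$⟩ʳ q) Fin.<? (σ ⟨$⟩ʳ p))

invAt? : (σ : Permutation′ n) → Decidable (uncurry (Inv σ) ∘ remQuot n)
invAt? {n} σ k = uncurry (inv? σ) (remQuot n k)

invSet : (σ : Permutation′ n) → Subset (n * n)
invSet σ = subsetOf (invAt? σ)

∈invSet⁺ : (σ : Permutation′ n) {p q : Fin n} → Inv σ p q → combine p q Subset.∈ invSet σ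
∈invSet⁺ σ {p} {q} inv =
  ∈subsetOf⁺ (invAt? σ) (subst (uncurry (Inv σ)) (sym (remQuot-combine p q)) inv)

∈invSet⁻ : (σ : Permutation′ n) {k : Fin (n * n)} → k Subset.∈ invSet σ → uncurry (Inv σ) (remQuot n k)
∈invSet⁻ σ = ∈subsetOf⁻ (invAt? σ)

len : Permutation′ n → ℕ
len σ = ∣ invSet σ ∣

⊑⇒invSet⊆ : {σ τ : Permutation′ n} → σ ⊑ τ → invSet σ Subset.⊆ invSet τ
⊑⇒invSet⊆ {σ = σ} {τ} σ⊑τ k∈ = ∈subsetOf⁺ (invAt? τ) (σ⊑τ (∈invSet⁻ σ k∈))

len-mono : {σ τ : Permutation′ n} → σ ⊑ τ → len σ ≤ len τ
len-mono {σ = σ} {τ} σ⊑τ = p⊆q⇒∣p∣≤∣q∣ (⊑⇒invSet⊆ {σ = σ} {τ} σ⊑τ)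

len-cong : {σ τ : Permutation′ n} → σ ≈ τ → len σ ≡ len τ
len-cong {σ = σ} {τ} eq = ℕ.≤-antisym (len-mono {σ = σ} {τ} (≈⇒⊑ {σ = σ} {τ} eq))
                              (len-mono {σ = τ} {σ} (≈⇒⊑ {σ = τ} {σ} (≈-sym {σ = σ} {τ} eq)))

len-id : len (id {n}) ≡ 0
len-id {n} = ℕ.n≤0⇒n≡0 (subst (∣ invSet (id {n}) ∣ ≤_) (∣⊥∣≡0 (n * n))
  (p⊆q⇒∣p∣≤∣q∣ {p = invSet (id {n})} {Subset.⊥} λ k∈ → ⊥-elim (uncurry ℕ.<-asym (∈invSet⁻ (id {n}) k∈))))

-- The length-free form of `i ∉ DesL σ` and `i ∈ DesL σ`: whether the letter `lower i` stands before
-- `upper i` in the word of `σ`.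
Asc Desc : Permutation′ (suc m) → Fin m → Set
Asc σ i = (σ ⟨$⟩ˡ lower i) Fin.< (σ ⟨$⟩ˡ upper i)
Desc σ i = (σ ⟨$⟩ˡ upper i) Fin.< (σ ⟨$⟩ˡ lower i)

asc-or-desc : (σ : Permutation′ (suc m)) (i : Fin m) → Asc σ i ⊎ Desc σ i
asc-or-desc σ i with Fin.<-cmp (σ ⟨$⟩ˡ lower i) (σ ⟨$⟩ˡ upper i)
... | tri< a _ _ = inj₁ a
... | tri> _ _ d = inj₂ d
... | tri≈ _ eq _ = contradiction (to-injective (flip σ) eq) (ℕ.<⇒≢ (lower<upper i) ∘ cong toℕ)

¬asc⇒desc : (σ : Permutation′ (suc m)) {i : Fin m} → ¬ Asc σ i → Desc σ i
¬asc⇒desc σ {i} ¬asc with asc-or-desc σ i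
... | inj₁ asc = contradiction asc ¬asc
... | inj₂ desc = desc

⊑-s : (σ : Permutation′ (suc m)) {i : Fin m} → Asc σ i → σ ⊑ s i · σ
⊑-s σ {i} asc {p} {q} (p<q , lt) with s-mono i lt
... | inj₁ lt′ = p<q , lt′
... | inj₂ (eq , eq′) = contradiction
        (subst₂ Fin._<_ (from-unique σ eq) (from-unique σ eq′) asc) (ℕ.<-asym p<q)

-- The only pair that can become inverted consists of the positions of the two exchanged letters.
s-inv⁻ : (σ : Permutation′ (suc m)) (i : Fin m) {p q : Fin (suc m)} → Inv (s i · σ) p q →
         Inv σ p q ⊎ (p ≡ σ ⟨$⟩ˡ lower i × q ≡ σ ⟨$⟩ˡ upper i)
s-inv⁻ σ i {p} {q} (p<q , lt) with s-mono i lt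
... | inj₁ lt′ = inj₁ (p<q , subst₂ Fin._<_ (s-involutive i _) (s-involutive i _) lt′)
... | inj₂ (eq , eq′) = inj₂
  ( sym (from-unique σ (trans (sym (s-involutive i _)) (trans (cong (s i ⟨$⟩ʳ_) eq′) (s-upper i))))
  , sym (from-unique σ (trans (sym (s-involutive i _)) (trans (cong (s i ⟨$⟩ʳ_) eq) (s-lower i)))))

s-inv : (σ : Permutation′ (suc m)) {i : Fin m} → Asc σ i →
        Inv (s i · σ) (σ ⟨$⟩ˡ lower i) (σ ⟨$⟩ˡ upper i)
s-inv σ {i} asc = asc , subst₂ Fin._<_
  (sym (trans (cong (s i ⟨$⟩ʳ_) (inverseʳ σ)) (s-upper i)))
  (sym (trans (cong (s i ⟨$⟩ʳ_) (inverseʳ σ)) (s-lower i)))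
  (lower<upper i)

len-asc : (σ : Permutation′ (suc m)) {i : Fin m} → Asc σ i → len σ < len (s i · σ)
len-asc {m} σ {i} asc = p⊂q⇒∣p∣<∣q∣
  ( ⊑⇒invSet⊆ {σ = σ} {s i · σ} (⊑-s σ asc)
  , combine (σ ⟨$⟩ˡ lower i) (σ ⟨$⟩ˡ upper i)
  , ∈invSet⁺ (s i · σ) (s-inv σ asc)
  , λ k∈ → ℕ.<-asym (lower<upper i) (subst₂ Fin._<_ (inverseʳ σ) (inverseʳ σ)
      (proj₂ (subst (uncurry (Inv σ)) (remQuot-combine _ _) (∈invSet⁻ σ k∈)))) )

len-s : (σ : Permutation′ (suc m)) (i : Fin m) → len (s i · σ) ≤ suc (len σ)
len-s {m} σ i = ∣∣-insert _ _ (combine (σ ⟨$⟩ˡ lower i) (σ ⟨$⟩ˡ upper i)) split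
  where
  split : ∀ {k} → k Subset.∈ invSet (s i · σ) → k Subset.∈ invSet σ ⊎ k ≡ _
  split {k} k∈ with s-inv⁻ σ i (∈invSet⁻ (s i · σ) k∈)
  ... | inj₁ inv = inj₁ (∈subsetOf⁺ (invAt? σ) inv)
  ... | inj₂ (eq , eq′) = inj₂ (trans (sym (Fin.combine-remQuot {suc m} (suc m) k)) (cong₂ combine eq eq′))

-- Words in the simple transpositions

eval-++ : (v w : List (Fin m)) → eval (v ++ w) ≈ eval v · eval w
eval-++ [] w k = refl
eval-++ (i ∷ v) w k = cong (s i ⟨$⟩ʳ_) (eval-++ v w k)

len≤length : (w : List (Fin m)) → len (eval w) ≤ length w
len≤length {m} [] = ℕ.≤-reflexive (len-id {suc m})
len≤length (i ∷ w) = ℕ.≤-trans (len-s (eval w) i) (s≤s (len≤length w))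

-- `⪯L` with its side condition on lengths replaced by `Asc`, available before Coxeter length has
-- been identified with `len`.
data Path {m : ℕ} (σ τ : Permutation′ (suc m)) : Set where
  done : σ ≈ τ → Path σ τ
  step : ∀ i → Asc σ i → Path (s i · σ) τ → Path σ τ

Path⇒⊑ : {σ τ : Permutation′ (suc m)} → Path σ τ → σ ⊑ τ
Path⇒⊑ {σ = σ} {τ} (done eq) = ≈⇒⊑ {σ = σ} {τ} eq
Path⇒⊑ {σ = σ} (step i asc path) inv = Path⇒⊑ path (⊑-s σ asc inv)

-- Reduces a comparison of two entries to comparisons of consecutive entries between them, the only
-- ones that descents control.
chain : {R : Fin (suc m) → Fin (suc m) → Set} → (∀ {i j k} → R i j → R j k → R i k) →
        ∀ {a b} → (∀ e → a Fin.≤ lower e → upper e Fin.≤ b → R (lower e) (upper e)) →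
        a Fin.< b → R a b
chain {m} {R} R-trans {a} {b} link a<b = go (toℕ b) b refl ℕ.≤-refl a<b
  where
  go : ∀ k c → toℕ c ≡ k → c Fin.≤ b → a Fin.< c → R a c
  go (suc k) (suc c) eq c≤b (s≤s a≤c)
    with a≤lower ← subst (toℕ a ≤_) (sym (toℕ-inject₁ c)) a≤c
    with ℕ.m≤n⇒m<n∨m≡n a≤lower
  ... | inj₁ a<c = R-trans
        (go k (lower c) (trans (toℕ-inject₁ c) (ℕ.suc-injective eq)) (ℕ.≤-trans (ℕ.<⇒≤ (lower<upper c)) c≤b) a<c)
        (link c a≤lower c≤b)
  ... | inj₂ a≡c = subst (λ x → R x (suc c)) (sym (toℕ-injective a≡c)) (link c a≤lower c≤b)

monotone⇒≤ : {f : Fin n → Fin n} → (∀ {i j} → i Fin.< j → f i Fin.< f j) → ∀ i → i Fin.≤ f i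
monotone⇒≤ {f = f} mono i = go (toℕ i) i refl
  where
  go : ∀ k i → toℕ i ≡ k → k ≤ toℕ (f i)
  go zero i _ = z≤n
  go (suc k) (suc i) eq = ℕ.≤-<-trans
    (go k (lower i) (trans (toℕ-inject₁ i) (ℕ.suc-injective eq))) (mono (lower<upper i))

reflects-< : (σ τ : Permutation′ n) → (∀ {p q} → (σ ⟨$⟩ʳ p) Fin.< (σ ⟨$⟩ʳ q) → (τ ⟨$⟩ʳ p) Fin.< (τ ⟨$⟩ʳ q)) →
             ∀ {p q} → (τ ⟨$⟩ʳ p) Fin.< (τ ⟨$⟩ʳ q) → (σ ⟨$⟩ʳ p) Fin.< (σ ⟨$⟩ʳ q)
reflects-< σ τ mono {p} {q} lt with Fin.<-cmp (σ ⟨$⟩ʳ p) (σ ⟨$⟩ʳ q)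
... | tri< lt′ _ _ = lt′
... | tri≈ _ eq _ = contradiction lt (ℕ.<-irrefl (cong (λ x → toℕ (τ ⟨$⟩ʳ x)) (to-injective σ eq)))
... | tri> _ _ gt = contradiction lt (ℕ.<-asym (mono gt))

-- Both `τ · flip σ` and its inverse are strictly increasing, so by `monotone⇒≤` neither lowers a
-- value.
same-order⇒≈ : (σ τ : Permutation′ n) →
  (∀ {p q} → (σ ⟨$⟩ʳ p) Fin.< (σ ⟨$⟩ʳ q) → (τ ⟨$⟩ʳ p) Fin.< (τ ⟨$⟩ʳ q)) → σ ≈ τ
same-order⇒≈ σ τ mono p = toℕ-injective (ℕ.≤-antisym
  (subst (λ x → σ ⟨$⟩ʳ p Fin.≤ (τ ⟨$⟩ʳ x)) (inverseˡ σ)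
    (monotone⇒≤ (λ lt → mono (subst₂ Fin._<_ (sym (inverseʳ σ)) (sym (inverseʳ σ)) lt)) (σ ⟨$⟩ʳ p)))
  (subst (λ x → τ ⟨$⟩ʳ p Fin.≤ (σ ⟨$⟩ʳ x)) (inverseˡ τ)
    (monotone⇒≤ (λ lt → reflects-< σ τ mono (subst₂ Fin._<_ (sym (inverseʳ τ)) (sym (inverseʳ τ)) lt)) (τ ⟨$⟩ʳ p))))

-- Look for consecutive letters in order in `σ` but inverted in `τ`. Exchanging them adds just one
-- inversion, which `τ` has as well. If there are none, `τ · flip σ` increases on consecutive
-- values, hence everywhere, and `σ ≈ τ`.
⊑⇒Path : (σ τ : Permutation′ (suc m)) → σ ⊑ τ → Path σ τ
⊑⇒Path {m} σ τ = go (len τ) σ (ℕ.m≤m+n _ _)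
  where
  -- The fuel `k` bounds the number of inversions still missing.
  go : ∀ k σ → len τ ≤ k + len σ → σ ⊑ τ → Path σ τ
  go k σ τ≤ σ⊑τ with any? (λ i → (σ ⟨$⟩ˡ lower i Fin.<? σ ⟨$⟩ˡ upper i)
                             ×-dec (τ ⟨$⟩ʳ (σ ⟨$⟩ˡ upper i) Fin.<? τ ⟨$⟩ʳ (σ ⟨$⟩ˡ lower i)))
  ... | no none = done (same-order⇒≈ σ τ λ {p} {q} lt →
          subst₂ (λ x y → (τ ⟨$⟩ʳ x) Fin.< (τ ⟨$⟩ʳ y)) (inverseˡ σ) (inverseˡ σ)
            (chain {R = λ x y → (τ ⟨$⟩ʳ (σ ⟨$⟩ˡ x)) Fin.< (τ ⟨$⟩ʳ (σ ⟨$⟩ˡ y))} ℕ.<-trans (λ i _ _ → inc i) lt))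
    where
    inc : ∀ i → (τ ⟨$⟩ʳ (σ ⟨$⟩ˡ lower i)) Fin.< (τ ⟨$⟩ʳ (σ ⟨$⟩ˡ upper i))
    inc i with asc-or-desc σ i
    ... | inj₂ desc = proj₂ (σ⊑τ (desc , subst₂ Fin._<_ (sym (inverseʳ σ)) (sym (inverseʳ σ)) (lower<upper i)))
    ... | inj₁ asc = Fin.≤∧≢⇒< (ℕ.≮⇒≥ (λ lt → none (i , asc , lt)))
            (λ eq → ℕ.<⇒≢ (lower<upper i) (cong toℕ (to-injective (flip σ) (to-injective τ eq))))
  ... | yes (i , asc , lt) = step i asc (next k τ≤)
    where
    s⊑τ : s i · σ ⊑ τ
    s⊑τ inv with s-inv⁻ σ i inv
    ... | inj₁ inv′ = σ⊑τ inv′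
    ... | inj₂ (refl , refl) = asc , lt
    next : ∀ k → len τ ≤ k + len σ → Path (s i · σ) τ
    next zero le = contradiction (ℕ.<-≤-trans (len-asc σ asc) (len-mono {σ = s i · σ} {τ} s⊑τ)) (ℕ.≤⇒≯ le)
    next (suc k) le = go k (s i · σ) (ℕ.≤-trans le
      (subst (_≤ k + len (s i · σ)) (ℕ.+-suc k _) (ℕ.+-monoʳ-≤ k (len-asc σ asc)))) s⊑τ

Path⇒word : {σ τ : Permutation′ (suc m)} → Path σ τ →
            ∃[ w ] (eval w · σ ≈ τ × length w + len σ ≤ len τ)
Path⇒word {σ = σ} {τ} (done eq) = [] , eq , ℕ.≤-reflexive (len-cong {σ = σ} {τ} eq)
Path⇒word {σ = σ} {τ} (step i asc path) with w , eq , le ← Path⇒word path =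
  w ++ [ i ] , (λ k → trans (eval-++ w [ i ] (σ ⟨$⟩ʳ k)) (eq k)) ,
  ℕ.≤-trans (ℕ.≤-reflexive (trans (cong (_+ len σ) (length-++ w)) (ℕ.+-assoc (length w) 1 (len σ))))
    (ℕ.≤-trans (ℕ.+-monoʳ-≤ (length w) (len-asc σ asc)) le)

id⊑ : (σ : Permutation′ n) → id ⊑ σ
id⊑ σ (p<q , q<p) = contradiction p<q (ℕ.<-asym q<p)

-- A path from `id` spells a word of at most `len σ` letters, and no word is shorter since each
-- letter adds at most one inversion.
hasLength : (σ : Permutation′ (suc m)) → σ HasLength len σ
hasLength {m} σ with w , eq , le ← Path⇒word (⊑⇒Path id σ (id⊑ σ)) =
  (w , ℕ.≤-antisym (ℕ.≤-trans (ℕ.m≤m+n _ (len (id {suc m}))) le) (minimal w eq) , eq) , minimal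
  where
  minimal : ∀ w → eval w ≈ σ → len σ ≤ length w
  minimal w eq = subst (_≤ length w) (len-cong {σ = eval w} {σ} eq) (len≤length w)

length-unique : {σ : Permutation′ (suc m)} {k : ℕ} → σ HasLength k → k ≡ len σ
length-unique {σ = σ} ((w , refl , eq) , minimal) with (w′ , eq′ , e′) , min′ ← hasLength σ =
  ℕ.≤-antisym (subst (length w ≤_) eq′ (minimal w′ e′)) (min′ w eq)

shorter⁺ : (σ τ : Permutation′ (suc m)) → len σ < len τ → σ Shorter τ
shorter⁺ σ τ lt = len σ , len τ , hasLength σ , hasLength τ , lt

shorter⁻ : (σ τ : Permutation′ (suc m)) → σ Shorter τ → len σ < len τ
shorter⁻ σ τ (k , l , hk , hl , lt) = subst₂ _<_ (length-unique {σ = σ} hk) (length-unique {σ = τ} hl) lt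

eval-reverse : (w : List (Fin m)) (σ : Permutation′ (suc m)) → eval w ≈ σ → eval (reverse w) ≈ flip σ
eval-reverse [] σ e k = sym (from-unique σ (sym (e k)))
eval-reverse (i ∷ w) σ e k rewrite unfold-reverse i w = trans (eval-++ (reverse w) [ i ] k)
  (trans (eval-reverse w (eval w) (λ _ → refl) (s i ⟨$⟩ʳ k))
    (sym (from-unique σ (trans (sym (e _))
      (trans (cong (s i ⟨$⟩ʳ_) (inverseʳ (eval w))) (s-involutive i k))))))

-- A shortest word read backwards evaluates to the inverse, so no bijection between the two
-- inversion sets has to be built.
len-flip≤ : (σ : Permutation′ (suc m)) → len (flip σ) ≤ len σ
len-flip≤ σ with (w , eq , e) , _ ← hasLength σ =
  ℕ.≤-trans (subst (_≤ length (reverse w)) (len-cong {σ = eval (reverse w)} {flip σ} (eval-reverse w σ e)) (len≤length (reverse w)))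
    (ℕ.≤-reflexive (trans (length-reverse w) eq))

len-flip : (σ : Permutation′ (suc m)) → len (flip σ) ≡ len σ
len-flip σ = ℕ.≤-antisym (len-flip≤ σ) (len-flip≤ (flip σ))

-- Descents and weak orders through inversions

asc⇒∉DesL : (σ : Permutation′ (suc m)) {i : Fin m} → Asc σ i → i ∉ DesL σ
asc⇒∉DesL σ asc short = ℕ.<-asym (len-asc σ asc) (shorter⁻ (s _ · σ) σ short)

desc⇒∈DesL : (σ : Permutation′ (suc m)) {i : Fin m} → Desc σ i → i ∈ DesL σ
desc⇒∈DesL σ {i} desc = shorter⁺ (s i · σ) σ (ℕ.<-≤-trans
  (len-asc (s i · σ) asc)
  (ℕ.≤-reflexive (len-cong {σ = s i · (s i · σ)} {σ} (λ k → s-involutive i (σ ⟨$⟩ʳ k)))))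
  where
  asc : Asc (s i · σ) i
  asc = subst₂ Fin._<_
    (cong (σ ⟨$⟩ˡ_) (sym (trans (s-from i (lower i)) (s-lower i))))
    (cong (σ ⟨$⟩ˡ_) (sym (trans (s-from i (upper i)) (s-upper i)))) desc

s-desc : (σ : Permutation′ (suc m)) {i : Fin m} → Asc σ i → Desc (s i · σ) i
s-desc σ {i} asc = subst₂ Fin._<_
  (cong (σ ⟨$⟩ˡ_) (sym (trans (s-from i (upper i)) (s-upper i))))
  (cong (σ ⟨$⟩ˡ_) (sym (trans (s-from i (lower i)) (s-lower i)))) asc

∉DesL⇒asc : (σ : Permutation′ (suc m)) {i : Fin m} → i ∉ DesL σ → Asc σ i
∉DesL⇒asc σ {i} i∉ with asc-or-desc σ i
... | inj₁ asc = asc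
... | inj₂ desc = contradiction (desc⇒∈DesL σ desc) i∉

∈DesL⇒desc : (σ : Permutation′ (suc m)) {i : Fin m} → i ∈ DesL σ → Desc σ i
∈DesL⇒desc σ {i} i∈ with asc-or-desc σ i
... | inj₁ asc = contradiction i∈ (asc⇒∉DesL σ asc)
... | inj₂ desc = desc

⪯L⇒Path : {σ τ : Permutation′ (suc m)} → σ ⪯L τ → Path σ τ
⪯L⇒Path (done eq) = done eq
⪯L⇒Path {σ = σ} (step i i∉ le) = step i (∉DesL⇒asc σ i∉) (⪯L⇒Path le)

Path⇒⪯L : {σ τ : Permutation′ (suc m)} → Path σ τ → σ ⪯L τ
Path⇒⪯L (done eq) = done eq
Path⇒⪯L {σ = σ} (step i asc path) = step i (asc⇒∉DesL σ asc) (Path⇒⪯L path)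

⪯L⇒⊑ : {σ τ : Permutation′ (suc m)} → σ ⪯L τ → σ ⊑ τ
⪯L⇒⊑ le = Path⇒⊑ (⪯L⇒Path le)

⊑⇒⪯L : (σ τ : Permutation′ (suc m)) → σ ⊑ τ → σ ⪯L τ
⊑⇒⪯L σ τ σ⊑τ = Path⇒⪯L (⊑⇒Path σ τ σ⊑τ)

⊑-antisym : (σ τ : Permutation′ n) → σ ⊑ τ → τ ⊑ σ → σ ≈ τ
⊑-antisym σ τ σ⊑τ τ⊑σ = same-order⇒≈ σ τ mono
  where
  mono : ∀ {p q} → (σ ⟨$⟩ʳ p) Fin.< (σ ⟨$⟩ʳ q) → (τ ⟨$⟩ʳ p) Fin.< (τ ⟨$⟩ʳ q)
  mono {p} {q} lt with Fin.<-cmp p q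
  ... | tri> _ _ q<p = proj₂ (σ⊑τ (q<p , lt))
  ... | tri≈ _ refl _ = contradiction lt (ℕ.<-irrefl refl)
  ... | tri< p<q _ _ with Fin.<-cmp (τ ⟨$⟩ʳ p) (τ ⟨$⟩ʳ q)
  ...   | tri< lt′ _ _ = lt′
  ...   | tri≈ _ eq _ = contradiction (to-injective τ eq) (ℕ.<⇒≢ p<q ∘ cong toℕ)
  ...   | tri> _ _ gt = contradiction lt (ℕ.<-asym (proj₂ (τ⊑σ (p<q , gt))))

-- Inversion turns right multiplication into left multiplication; all facts about `DesR` and `⪯R`
-- are obtained through it.
flip-·-s : (σ : Permutation′ (suc m)) (i : Fin m) → s i · flip σ ≈ flip (σ · s i)
flip-·-s σ i k = sym (s-from i (σ ⟨$⟩ˡ k))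

len-·-s : (σ : Permutation′ (suc m)) (i : Fin m) → len (σ · s i) ≡ len (s i · flip σ)
len-·-s σ i = trans (sym (len-flip (σ · s i)))
  (sym (len-cong {σ = s i · flip σ} {flip (σ · s i)} (flip-·-s σ i)))

∈DesR⇒desc : (σ : Permutation′ (suc m)) {i : Fin m} → i ∈ DesR σ → Desc (flip σ) i
∈DesR⇒desc σ {i} i∈ = ∈DesL⇒desc (flip σ) (shorter⁺ (s i · flip σ) (flip σ)
  (subst₂ _<_ (len-·-s σ i) (sym (len-flip σ)) (shorter⁻ (σ · s i) σ i∈)))

∉DesR⇒asc : (σ : Permutation′ (suc m)) {i : Fin m} → i ∉ DesR σ → Asc (flip σ) i
∉DesR⇒asc σ {i} i∉ = ∉DesL⇒asc (flip σ) λ i∈ → i∉ (shorter⁺ (σ · s i) σ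
  (subst₂ _<_ (sym (len-·-s σ i)) (len-flip σ) (shorter⁻ (s i · flip σ) (flip σ) i∈)))

⪯R⇒⊑ : {σ τ : Permutation′ (suc m)} → σ ⪯R τ → flip σ ⊑ flip τ
⪯R⇒⊑ {σ = σ} {τ} (done eq) = ≈⇒⊑ {σ = flip σ} {flip τ} (flip-cong {σ = σ} {τ} eq)
⪯R⇒⊑ {σ = σ} (step i i∉ le) inv = ⪯R⇒⊑ le
  (≈⇒⊑ {σ = s i · flip σ} {flip (σ · s i)} (flip-·-s σ i) (⊑-s (flip σ) (∉DesR⇒asc σ i∉) inv))

⊑⇒⪯R : (σ τ : Permutation′ (suc m)) → flip σ ⊑ flip τ → σ ⪯R τ
⊑⇒⪯R σ τ le = go σ (⊑⇒Path (flip σ) (flip τ) le) (λ _ → refl)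
  where
  -- The path runs through inverses, and `s i · flip σ` agrees with `flip (σ · s i)` only pointwise;
  -- `σ′` absorbs the difference.
  go : ∀ {σ′} σ → Path σ′ (flip τ) → σ′ ≈ flip σ → σ ⪯R τ
  go {σ′} σ (done eq) e = done (λ k → from-unique (flip σ) (trans (sym (e _)) (trans (eq _) (inverseˡ τ))))
  go {σ′} σ (step i asc path) e = step i
    (λ i∈ → ℕ.<-asym (subst₂ Fin._<_ (flip-cong {σ = σ′} {flip σ} e _) (flip-cong {σ = σ′} {flip σ} e _) asc)
              (∈DesR⇒desc σ i∈))
    (go (σ · s i) path (λ k → trans (cong (s i ⟨$⟩ʳ_) (e k)) (flip-·-s σ i k)))

-- Permutations that sort by a key

injective⇒surjective : {f : Fin n → Fin n} → (∀ {i j} → f i ≡ f j → i ≡ j) → ∀ v → ∃[ i ] f i ≡ v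
injective⇒surjective {suc n} {f} inj v with any? (λ i → f i Fin.≟ v)
... | yes hit = hit
... | no miss = contradiction
        (injective⇒≤ {f = λ i → punchOut (avoid i)} λ eq → inj (punchOut-injective (avoid _) (avoid _) eq))
        ℕ.1+n≰n
  where
  avoid : ∀ i → v ≢ f i
  avoid i eq = miss (i , sym eq)

injective⇒permutation : (f : Fin n → Fin n) → (∀ {i j} → f i ≡ f j → i ≡ j) → Permutation′ n
injective⇒permutation f inj = permutation f (λ v → proj₁ (surj v)) (λ v → proj₂ (surj v))
  (λ i → inj (proj₂ (surj (f i))))
  where surj = injective⇒surjective inj

-- Reversing ties lets one construction give `w₀` (constant key), longest elements of parabolic
-- subgroups (key constant on blocks) and the right-to-left reading orders (key depending on the
-- row).
module Rank (key : Fin n → ℕ) where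

  -- Ties are broken in favour of the larger index.
  infix 4 _≺_
  _≺_ : Fin n → Fin n → Set
  i ≺ j = key i < key j ⊎ (key i ≡ key j × j Fin.< i)

  ≺? : ∀ i j → Dec (i ≺ j)
  ≺? i j = (key i ℕ.<? key j) ⊎-dec ((key i ℕ.≟ key j) ×-dec (j Fin.<? i))

  ≺-irrefl : ∀ {i} → ¬ i ≺ i
  ≺-irrefl (inj₁ lt) = ℕ.<-irrefl refl lt
  ≺-irrefl (inj₂ (_ , lt)) = ℕ.<-irrefl refl lt

  ≺-trans : ∀ {i j k} → i ≺ j → j ≺ k → i ≺ k
  ≺-trans (inj₁ lt) (inj₁ lt′) = inj₁ (ℕ.<-trans lt lt′)
  ≺-trans {i} (inj₁ lt) (inj₂ (eq , _)) = inj₁ (subst (key i <_) eq lt)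
  ≺-trans {k = k} (inj₂ (eq , _)) (inj₁ lt′) = inj₁ (subst (_< key k) (sym eq) lt′)
  ≺-trans (inj₂ (eq , lt)) (inj₂ (eq′ , lt′)) = inj₂ (trans eq eq′ , ℕ.<-trans lt′ lt)

  ≺-connex : ∀ i j → i ≡ j ⊎ i ≺ j ⊎ j ≺ i
  ≺-connex i j with ℕ.<-cmp (key i) (key j)
  ... | tri< lt _ _ = inj₂ (inj₁ (inj₁ lt))
  ... | tri> _ _ gt = inj₂ (inj₂ (inj₁ gt))
  ... | tri≈ _ eq _ with Fin.<-cmp i j
  ...   | tri< lt _ _ = inj₂ (inj₂ (inj₂ (sym eq , lt)))
  ...   | tri≈ _ i≡j _ = inj₁ i≡j
  ...   | tri> _ _ gt = inj₂ (inj₁ (inj₂ (eq , gt)))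

  below : Fin n → Subset n
  below j = subsetOf (λ i → ≺? i j)

  rankℕ : Fin n → ℕ
  rankℕ j = ∣ below j ∣

  rankℕ-mono : ∀ {i j} → i ≺ j → rankℕ i < rankℕ j
  rankℕ-mono {i} {j} i≺j = p⊂q⇒∣p∣<∣q∣
    ( (λ k∈ → ∈subsetOf⁺ (λ k → ≺? k j) (≺-trans (∈subsetOf⁻ (λ k → ≺? k i) k∈) i≺j))
    , i , ∈subsetOf⁺ (λ k → ≺? k j) i≺j , λ i∈ → ≺-irrefl (∈subsetOf⁻ (λ k → ≺? k i) i∈))

  rankℕ<n : ∀ j → rankℕ j < n
  rankℕ<n j = subst (rankℕ j <_) (∣⊤∣≡n n) (p⊂q⇒∣p∣<∣q∣
    ((λ _ → ∈⊤) , j , ∈⊤ , λ j∈ → ≺-irrefl (∈subsetOf⁻ (λ k → ≺? k j) j∈)))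

  rankFin : Fin n → Fin n
  rankFin j = Fin.fromℕ< (rankℕ<n j)

  rankFin-mono : ∀ {i j} → i ≺ j → rankFin i Fin.< rankFin j
  rankFin-mono i≺j = subst₂ _<_ (sym (Fin.toℕ-fromℕ< _)) (sym (Fin.toℕ-fromℕ< _)) (rankℕ-mono i≺j)

  rankFin-injective : ∀ {i j} → rankFin i ≡ rankFin j → i ≡ j
  rankFin-injective {i} {j} eq with ≺-connex i j
  ... | inj₁ i≡j = i≡j
  ... | inj₂ (inj₁ lt) = contradiction (cong toℕ eq) (ℕ.<⇒≢ (rankFin-mono lt))
  ... | inj₂ (inj₂ gt) = contradiction (cong toℕ (sym eq)) (ℕ.<⇒≢ (rankFin-mono gt))

  abstract

    rank : Permutation′ n
    rank = injective⇒permutation rankFin rankFin-injective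

    toℕ-rank : ∀ j → toℕ (rank ⟨$⟩ʳ j) ≡ ∣ below j ∣
    toℕ-rank j = Fin.toℕ-fromℕ< (rankℕ<n j)

    rank-mono : ∀ {i j} → i ≺ j → (rank ⟨$⟩ʳ i) Fin.< (rank ⟨$⟩ʳ j)
    rank-mono = rankFin-mono

  rank-cancel : ∀ {i j} → (rank ⟨$⟩ʳ i) Fin.< (rank ⟨$⟩ʳ j) → i ≺ j
  rank-cancel {i} {j} lt with ≺-connex i j
  ... | inj₁ refl = contradiction lt (ℕ.<-irrefl refl)
  ... | inj₂ (inj₁ i≺j) = i≺j
  ... | inj₂ (inj₂ j≺i) = contradiction lt (ℕ.<-asym (rank-mono j≺i))

open Rank using (rank; rank-mono; rank-cancel)

-- Longest elements of parabolic subgroups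

-- Needed because `rank-longest` concerns a filling, whereas the least element of an interval is the
-- inverse of one.
IsLongest-flip : {S : Pred (Fin m) 0ℓ} {σ : Permutation′ (suc m)} → IsLongest ⟨ S ⟩ σ → IsLongest ⟨ S ⟩ (flip σ)
IsLongest-flip {S = S} {σ} ((w , w∈ , eq) , k , hk , max) =
  (reverse w , All.tabulate (λ x∈ → All.lookup w∈ (Any.reverse⁻ x∈)) , eval-reverse w σ eq) , len (flip σ) , hasLength (flip σ) ,
  λ τ l τ∈ hl → subst (l ≤_) (trans (length-unique {σ = σ} hk) (sym (len-flip σ))) (max τ l τ∈ hl)

-- The classes of `key` are the blocks of the parabolic subgroup of `S`; its longest element
-- reverses every block and keeps the blocks in order.
module _ (key : Fin (suc m) → ℕ) (mono : ∀ {i j} → i Fin.< j → key i ≤ key j)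
         (S : Pred (Fin m) 0ℓ) (S⇒tie : ∀ {i} → i ∈ S → key (lower i) ≡ key (upper i))
         (tie⇒S : ∀ {i} → key (lower i) ≡ key (upper i) → i ∈ S) where

  private
    ρ = rank key

    s-key : ∀ {i} → i ∈ S → ∀ k → key (s i ⟨$⟩ʳ k) ≡ key k
    s-key {i} i∈ k with s i ⟨$⟩ʳ k | swapView i k
    ... | _ | is-lower = sym (S⇒tie i∈)
    ... | _ | is-upper = S⇒tie i∈
    ... | _ | is-other _ _ = refl

    ⟨S⟩-key : ∀ w → All S w → ∀ k → key (eval w ⟨$⟩ʳ k) ≡ key k
    ⟨S⟩-key [] [] k = refl
    ⟨S⟩-key (i ∷ w) (i∈ ∷ w∈) k = trans (s-key i∈ _) (⟨S⟩-key w w∈ k)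

    -- A member of the subgroup preserves `key`, so its inversions lie inside classes, and `ρ`
    -- inverts every such pair.
    ⟨S⟩⊑ : ∀ {τ} → τ ∈ ⟨ S ⟩ → τ ⊑ ρ
    ⟨S⟩⊑ {τ} (w , w∈ , eq) {p} {q} (p<q , τq<τp) = p<q , rank-mono key (inj₂
      (ℕ.≤-antisym (subst₂ _≤_ (keyτ q) (keyτ p) (mono τq<τp)) (mono p<q) , p<q))
      where
      keyτ : ∀ k → key (τ ⟨$⟩ʳ k) ≡ key k
      keyτ k = trans (cong key (sym (eq k))) (⟨S⟩-key w w∈ k)

    -- Every step of a path below ρ stays within the classes of key.
    path-word : ∀ {σ} → (∀ k → key (σ ⟨$⟩ʳ k) ≡ key k) → Path σ ρ → ∃[ w ] (All S w × eval w · σ ≈ ρ)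
    path-word inv (done eq) = [] , [] , eq
    path-word {σ} inv (step i asc path) =
      extend (path-word {s i · σ} (λ k → trans (s-key i∈ _) (inv k)) path)
      where
      -- The pair exchanged by this step remains inverted in `ρ`, which inverts pairs inside a class
      -- only.
      tie : key (σ ⟨$⟩ˡ lower i) ≡ key (σ ⟨$⟩ˡ upper i)
      tie with rank-cancel key (proj₂ (Path⇒⊑ path (s-inv σ asc)))
      ... | inj₁ lt = contradiction (mono asc) (ℕ.<⇒≱ lt)
      ... | inj₂ (eq , _) = sym eq
      from-key : ∀ v → key (σ ⟨$⟩ˡ v) ≡ key v
      from-key v = trans (sym (inv _)) (cong key (inverseʳ σ))
      i∈ : i ∈ S
      i∈ = tie⇒S (trans (sym (from-key _)) (trans tie (from-key _)))
      extend : ∃[ w ] (All S w × eval w · (s i · σ) ≈ ρ) → ∃[ w ] (All S w × eval w · σ ≈ ρ)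
      extend (w , w∈ , eq) = w ++ [ i ] , All.++⁺ w∈ (i∈ ∷ []) , λ k → trans (eval-++ w [ i ] _) (eq k)

  rank-longest : IsLongest ⟨ S ⟩ ρ
  rank-longest = path-word {id} (λ _ → refl) (⊑⇒Path id ρ (id⊑ ρ)) , len ρ , hasLength ρ ,
    λ τ l τ∈ hl → subst (_≤ len ρ) (sym (length-unique {σ = τ} hl)) (len-mono {σ = τ} {ρ} (⟨S⟩⊑ {τ} τ∈))

w₀ : Permutation′ n
w₀ = rank (λ _ → 0)

w₀-anti : {i j : Fin n} → i Fin.< j → (w₀ {n} ⟨$⟩ʳ j) Fin.< (w₀ {n} ⟨$⟩ʳ i)
w₀-anti i<j = rank-mono (λ _ → 0) (inj₂ (refl , i<j))

w₀-anti⁻ : {i j : Fin n} → (w₀ {n} ⟨$⟩ʳ j) Fin.< (w₀ {n} ⟨$⟩ʳ i) → i Fin.< j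
w₀-anti⁻ lt with inj₂ (_ , i<j) ← rank-cancel (λ _ → 0) lt = i<j

w₀-longest : Is-w₀ (w₀ {suc m})
w₀-longest {m} = _ , len (w₀ {suc m}) , hasLength (w₀ {suc m}) ,
  λ τ l _ hl → subst (_≤ len (w₀ {suc m})) (sym (length-unique {σ = τ} hl))
    (len-mono {σ = τ} {w₀} λ (p<q , _) → p<q , w₀-anti p<q)

-- Isomorphisms of left weak order that preserve descents

s≉ : (σ : Permutation′ (suc m)) {i : Fin m} → Asc σ i → ¬ (σ ≈ s i · σ)
s≉ σ {i} asc eq = ℕ.<-irrefl (len-cong {σ = σ} {s i · σ} eq) (len-asc σ asc)

-- An element strictly in between would need two increases of length, while `s i` provides only one.
cover : (σ τ : Permutation′ (suc m)) {i : Fin m} → Path σ τ → Path τ (s i · σ) → σ ≈ τ ⊎ τ ≈ s i · σ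
cover σ τ (done eq) _ = inj₁ eq
cover σ τ (step j asc path) (done eq) = inj₂ eq
cover σ τ {i} (step j asc path) (step k asc′ path′) = contradiction (begin-strict
  suc (len σ)       ≤⟨ len-asc σ asc ⟩
  len (s j · σ)     ≤⟨ len-mono {σ = s j · σ} {τ} (Path⇒⊑ path) ⟩
  len τ             <⟨ len-asc τ asc′ ⟩
  len (s k · τ)     ≤⟨ len-mono {σ = s k · τ} {s i · σ} (Path⇒⊑ path′) ⟩
  len (s i · σ)     ∎) (ℕ.≤⇒≯ (len-s σ i))
  where open ℕ.≤-Reasoning

-- If the pairs of letters exchanged by `s i` and `s j` are disjoint, `s j` does not affect `i`. If
-- they share one letter, the two ascents place three consecutive letters in increasing positions,
-- and the letters of `i` stay in order after the exchange.
new-descent : (σ : Permutation′ (suc m)) {i j : Fin m} → Asc σ i → Asc σ j → Desc (s j · σ) i → i ≡ j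
new-descent σ {i} {j} asc-i asc-j desc = go (i Fin.≟ j) (upper i Fin.≟ lower j) (lower i Fin.≟ upper j)
  where
  pos = σ ⟨$⟩ˡ_
  desc′ : ∀ {a b} → s j ⟨$⟩ʳ upper i ≡ a → s j ⟨$⟩ʳ lower i ≡ b → pos a Fin.< pos b
  desc′ eq eq′ = subst₂ Fin._<_ (cong pos (trans (s-from j (upper i)) eq)) (cong pos (trans (s-from j (lower i)) eq′)) desc
  go : Dec (i ≡ j) → Dec (upper i ≡ lower j) → Dec (lower i ≡ upper j) → i ≡ j
  go (yes i≡j) _ _ = i≡j
  go (no i≢j) (yes u≡l) _ = contradiction
    (desc′ (trans (cong (s j ⟨$⟩ʳ_) u≡l) (s-lower j))
           (s-other j (i≢j ∘ Fin.inject₁-injective)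
              (λ l≡u → ℕ.<-asym (lower<upper i) (subst₂ Fin._<_ (sym u≡l) (sym l≡u) (lower<upper j)))))
    (ℕ.<-asym (ℕ.<-trans asc-i (subst (λ x → pos x Fin.< pos (upper j)) (sym u≡l) asc-j)))
  go (no i≢j) (no u≢l) (yes l≡u) = contradiction
    (desc′ (s-other j u≢l (i≢j ∘ Fin.suc-injective))
           (trans (cong (s j ⟨$⟩ʳ_) l≡u) (s-upper j)))
    (ℕ.<-asym (ℕ.<-trans (subst (λ x → pos (lower j) Fin.< pos x) (sym l≡u) asc-j) asc-i))
  go (no i≢j) (no u≢l) (no l≢u) = contradiction
    (desc′ (s-other j u≢l (i≢j ∘ Fin.suc-injective)) (s-other j (i≢j ∘ Fin.inject₁-injective) l≢u))
    (ℕ.<-asym asc-i)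

Convex : Pred (Permutation′ n) 0ℓ → Set
Convex W = ∀ {σ τ υ} → σ ∈ W → υ ∈ W → σ ⊑ τ → τ ⊑ υ → τ ∈ W

-- `W` is given as a set of words without endpoints; convexity is what lets covers be carried over
-- to it.
module Rigid (I : Interval m) (W : Pred (Permutation′ (suc m)) 0ℓ) (convex : Convex W) (iso : ⟦ I ⟧ ∼D W) where

  private
    f = proj₁ iso
    module F = IsOrderIsomorphism (proj₁ (proj₂ iso))
    same-descents = proj₂ (proj₂ iso)

  lo∈ : lo I ∈ ⟦ I ⟧
  lo∈ = done (λ _ → refl) , lo⪯hi I

  hi∈ : hi I ∈ ⟦ I ⟧
  hi∈ = lo⪯hi I , done (λ _ → refl)

  image : ∀ σ → σ ∈ ⟦ I ⟧ → Permutation′ (suc m)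
  image σ σ∈ = proj₁ (f (σ , σ∈))

  -- A cover goes to a cover s j, and preservation of descents forces j to be i.
  image-step : ∀ σ i → Asc σ i → (σ∈ : σ ∈ ⟦ I ⟧) (s∈ : s i · σ ∈ ⟦ I ⟧) →
               image (s i · σ) s∈ ≈ s i · image σ σ∈
  image-step σ i asc σ∈ s∈ = go (⪯L⇒Path (F.mono (⊑⇒⪯L σ (s i · σ) (⊑-s σ asc))))
    where
    go : Path (image σ σ∈) (image (s i · σ) s∈) → image (s i · σ) s∈ ≈ s i · image σ σ∈
    go (done eq) = contradiction (F.injective {σ , σ∈} {s i · σ , s∈} eq) (s≉ σ asc)
    -- By convexity the first step of the image path stays in `W`, so it is the image of some `x`;
    -- cancelling the isomorphism squeezes `x` into the cover from `σ` to `s i · σ`.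
    go (step j asc′ path) with (x , x∈) , hit ← F.surjective
      (s j · image σ σ∈ , convex {image σ σ∈} {s j · image σ σ∈} {image (s i · σ) s∈}
        (proj₂ (f (σ , σ∈))) (proj₂ (f (s i · σ , s∈))) (⊑-s (image σ σ∈) asc′) (Path⇒⊑ path))
      = conclude (cover σ x
          (⪯L⇒Path (F.cancel {σ , σ∈} {x , x∈} (⊑⇒⪯L (image σ σ∈) (image x x∈)
            (λ inv → ≈⇒⊑ {σ = ε} {image x x∈} (≈-sym {σ = image x x∈} {ε} fx) (⊑-s (image σ σ∈) asc′ inv)))))
          (⪯L⇒Path (F.cancel {x , x∈} {s i · σ , s∈} (⊑⇒⪯L (image x x∈) (image (s i · σ) s∈)
            (λ inv → Path⇒⊑ path (≈⇒⊑ {σ = image x x∈} {ε} fx inv))))))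
      where
      ε = s j · image σ σ∈
      fx : image x x∈ ≈ ε
      fx = hit {x , x∈} (λ _ → refl)
      conclude : σ ≈ x ⊎ x ≈ s i · σ → image (s i · σ) s∈ ≈ s i · image σ σ∈
      conclude (inj₁ eq) = contradiction
        (≈-trans {σ = image σ σ∈} {image x x∈} {ε} (F.cong {σ , σ∈} {x , x∈} eq) fx) (s≉ (image σ σ∈) asc′)
      conclude (inj₂ eq) = subst (λ i → image (s _ · σ) s∈ ≈ s i · image σ σ∈) (sym i≡j) fs
        where
        fs : image (s i · σ) s∈ ≈ ε
        fs = ≈-trans {σ = image (s i · σ) s∈} {image x x∈} {ε}
          (≈-sym {σ = image x x∈} {image (s i · σ) s∈} (F.cong {x , x∈} {s i · σ , s∈} eq)) fx
        i∈ : i ∈ DesL (image (s i · σ) s∈)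
        i∈ = proj₂ (same-descents (s i · σ , s∈)) (desc⇒∈DesL (s i · σ)
          (s-desc σ asc))
        i≡j : i ≡ j
        i≡j = new-descent (image σ σ∈)
          (∉DesL⇒asc (image σ σ∈) (λ i∈ → asc⇒∉DesL σ asc (proj₁ (same-descents (σ , σ∈)) i∈)))
          asc′ (subst₂ Fin._<_ (flip-cong {σ = image (s i · σ) s∈} {ε} fs _) (flip-cong {σ = image (s i · σ) s∈} {ε} fs _)
                  (∈DesL⇒desc (image (s i · σ) s∈) i∈))

  -- Each cover multiplies argument and image on the left by the same `s i`, so the right factor `π`
  -- never changes.
  image-translate : ∀ σ τ → Path σ τ → (σ∈ : σ ∈ ⟦ I ⟧) (τ∈ : τ ∈ ⟦ I ⟧) →
                    ∀ π → image σ σ∈ ≈ σ · π → image τ τ∈ ≈ τ · π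
  image-translate σ τ (done eq) σ∈ τ∈ π eq′ k =
    trans (F.cong {τ , τ∈} {σ , σ∈} (≈-sym {σ = σ} {τ} eq) k) (trans (eq′ k) (eq _))
  image-translate σ τ (step i asc path) σ∈ τ∈ π eq′ = image-translate (s i · σ) τ path s∈ τ∈ π
    λ k → trans (image-step σ i asc σ∈ s∈ k) (cong (s i ⟨$⟩ʳ_) (eq′ k))
    where
    s∈ : s i · σ ∈ ⟦ I ⟧
    s∈ = ⊑⇒⪯L (lo I) (s i · σ) (λ inv → ⊑-s σ asc (⪯L⇒⊑ (proj₁ σ∈) inv))
       , ⊑⇒⪯L (s i · σ) (hi I) (λ inv → ⪯L⇒⊑ (proj₂ τ∈) (Path⇒⊑ path inv))

  shiftR : Permutation′ (suc m)
  shiftR = flip (lo I) · image (lo I) lo∈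

  image≈ : ∀ τ (τ∈ : τ ∈ ⟦ I ⟧) → image τ τ∈ ≈ τ · shiftR
  image≈ τ τ∈ = image-translate (lo I) τ (⪯L⇒Path (proj₁ τ∈)) lo∈ τ∈ shiftR
    (λ k → sym (inverseʳ (lo I)))

-- Tableaux and fillings as permutations

-- The boxes of tcd(α) are numbered along rows, bottom row first; row i and
-- column i are the coordinates of the i-th box, columns starting at 0.
module Tableaux {m : ℕ} (row column : Fin (suc m) → ℕ)
  (row-mono : ∀ {i j} → i Fin.< j → row i ≤ row j)
  (column-mono : ∀ {i j} → i Fin.< j → row i ≡ row j → column i < column j)
  (row-start : ∀ i → ∃[ t ] (row t ≡ row i × column t ≡ 0))
  (bound : ℕ) (row≤bound : ∀ i → row i < bound)
  where

  Cell′ : Set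
  Cell′ = Fin (suc m)

  private variable
    a b i j : Cell′
    F G σ τ T V : Permutation′ (suc m)

  -- The strict orders of the diagram 𝒟 and of its reflection, transported to
  -- the boxes of tcd(α).  A filling is the permutation sending a cell to its entry.
  infix 4 _<D_ _<X_
  _<D_ _<X_ : Cell′ → Cell′ → Set
  i <D j = i Fin.< j × (row i ≡ row j ⊎ column i ≡ 0)
  i <X j = (row i ≡ row j × j Fin.< i) ⊎ (row i < row j × (column i ≢ 0 ⊎ column j ≡ 0))

  Immaculate Standard : Permutation′ (suc m) → Set
  Immaculate T = ∀ {i j} → i <D j → (T ⟨$⟩ʳ i) Fin.< (T ⟨$⟩ʳ j)
  Standard F = ∀ {i j} → i <X j → (F ⟨$⟩ʳ i) Fin.< (F ⟨$⟩ʳ j)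

  Immaculate-resp : T ≈ V → Immaculate T → Immaculate V
  Immaculate-resp eq imm lt = subst₂ Fin._<_ (eq _) (eq _) (imm lt)

  row-< : row i < row j → i Fin.< j
  row-< {i} {j} lt = ℕ.≰⇒> λ j≤i → ℕ.<⇒≱ lt (weak j≤i)
    where
    weak : j Fin.≤ i → row j ≤ row i
    weak j≤i with ℕ.m≤n⇒m<n∨m≡n j≤i
    ... | inj₁ j<i = row-mono j<i
    ... | inj₂ j≡i = ℕ.≤-reflexive (cong row (toℕ-injective j≡i))

  -- Reflection turns the columns of 𝒟 upside down, which is why `same` pairs are reversed in `<X`.
  -- Only `free` pairs are undecided by `<X`, and only `cross` pairs by `<D`.
  data Kind (i j : Cell′) : Set where
    same  : row i ≡ row j → i <D j → j <X i → Kind i j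
    both  : row i < row j → column i ≡ 0 → column j ≡ 0 → i <D j → i <X j → Kind i j
    -- the pairs that are comparable in 𝒟 but not in its reflection
    free  : row i < row j → column i ≡ 0 → column j ≢ 0 → i <D j → Kind i j
    cross : row i < row j → column i ≢ 0 → i <X j → Kind i j

  kind : i Fin.< j → Kind i j
  kind {i} {j} i<j with ℕ.m≤n⇒m<n∨m≡n (row-mono i<j)
  ... | inj₂ eq = same eq (i<j , inj₁ eq) (inj₁ (sym eq , i<j))
  ... | inj₁ lt with column i ℕ.≟ 0 | column j ℕ.≟ 0
  ...   | no ≢0 | _ = cross lt ≢0 (inj₂ (lt , inj₁ ≢0))
  ...   | yes ≡0 | yes ≡0′ = both lt ≡0 ≡0′ (i<j , inj₂ ≡0) (inj₂ (lt , inj₂ ≡0′))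
  ...   | yes ≡0 | no ≢0 = free lt ≡0 ≢0 (i<j , inj₂ ≡0)

  disagree⇒free : Standard F → Standard G → (F ⟨$⟩ʳ b) Fin.< (F ⟨$⟩ʳ a) → (G ⟨$⟩ʳ a) Fin.< (G ⟨$⟩ʳ b) →
             (row a < row b × column a ≡ 0 × column b ≢ 0 × a <D b)
             ⊎ (row b < row a × column b ≡ 0 × column a ≢ 0 × b <D a)
  disagree⇒free {b = b} {a = a} stF stG Fb<Fa Ga<Gb with Fin.<-cmp a b
  ... | tri≈ _ refl _ = contradiction Fb<Fa (ℕ.<-irrefl refl)
  ... | tri< a<b _ _ with kind a<b
  ...   | same _ _ b<a = contradiction (stG b<a) (ℕ.<-asym Ga<Gb)
  ...   | both _ _ _ _ a<b = contradiction (stF a<b) (ℕ.<-asym Fb<Fa)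
  ...   | free lt c c′ d = inj₁ (lt , c , c′ , d)
  ...   | cross _ _ a<b = contradiction (stF a<b) (ℕ.<-asym Fb<Fa)
  disagree⇒free stF stG Fb<Fa Ga<Gb | tri> _ _ b<a with kind b<a
  ...   | same _ _ a<b = contradiction (stF a<b) (ℕ.<-asym Fb<Fa)
  ...   | both _ _ _ _ b<a = contradiction (stG b<a) (ℕ.<-asym Ga<Gb)
  ...   | free lt c c′ d = inj₂ (lt , c , c′ , d)
  ...   | cross _ _ b<a = contradiction (stG b<a) (ℕ.<-asym Ga<Gb)

  -- Comparing words of tableaux along one or two fillings

  <-or-> : (F : Permutation′ (suc m)) → a ≢ b → (F ⟨$⟩ʳ a) Fin.< (F ⟨$⟩ʳ b) ⊎ (F ⟨$⟩ʳ b) Fin.< (F ⟨$⟩ʳ a)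
  <-or-> {a} {b} F ≢ with Fin.<-cmp (F ⟨$⟩ʳ a) (F ⟨$⟩ʳ b)
  ... | tri< lt _ _ = inj₁ lt
  ... | tri≈ _ eq _ = contradiction (to-injective F eq) ≢
  ... | tri> _ _ gt = inj₂ gt

  -- The dictionary between positions and cells: an inversion of `T · flip F` is a pair of cells on
  -- which `F` and `T` disagree.
  word-⊑ : (T V F : Permutation′ (suc m)) →
           (∀ {a b} → (F ⟨$⟩ʳ a) Fin.< (F ⟨$⟩ʳ b) → (T ⟨$⟩ʳ b) Fin.< (T ⟨$⟩ʳ a) → (V ⟨$⟩ʳ b) Fin.< (V ⟨$⟩ʳ a)) →
           T · flip F ⊑ V · flip F
  word-⊑ T V F hyp (p<q , lt) = p<q , hyp (subst₂ Fin._<_ (sym (inverseʳ F)) (sym (inverseʳ F)) p<q) lt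

  word-⊑⁻ : (T V F : Permutation′ (suc m)) → T · flip F ⊑ V · flip F →
            (F ⟨$⟩ʳ a) Fin.< (F ⟨$⟩ʳ b) → (T ⟨$⟩ʳ b) Fin.< (T ⟨$⟩ʳ a) → (V ⟨$⟩ʳ b) Fin.< (V ⟨$⟩ʳ a)
  word-⊑⁻ T V F le Fa<Fb lt = subst₂ (λ x y → (V ⟨$⟩ʳ x) Fin.< (V ⟨$⟩ʳ y)) (inverseˡ F) (inverseˡ F)
    (proj₂ (le (Fa<Fb , subst₂ (λ x y → (T ⟨$⟩ʳ x) Fin.< (T ⟨$⟩ʳ y)) (sym (inverseˡ F)) (sym (inverseˡ F)) lt)))

  -- Passing from `F` to `G` changes the order of free pairs only. These are comparable in `<D`, so
  -- `T` and `V` agree on them.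
  transport-⊑ : (T V F G : Permutation′ (suc m)) → Standard F → Standard G → Immaculate T → Immaculate V →
                T · flip F ⊑ V · flip F → T · flip G ⊑ V · flip G
  transport-⊑ T V F G stF stG immT immV le = word-⊑ T V G step′
    where
    step′ : ∀ {a b} → (G ⟨$⟩ʳ a) Fin.< (G ⟨$⟩ʳ b) → (T ⟨$⟩ʳ b) Fin.< (T ⟨$⟩ʳ a) → (V ⟨$⟩ʳ b) Fin.< (V ⟨$⟩ʳ a)
    step′ {a} {b} Ga<Gb Tb<Ta with <-or-> {a} {b} F (λ eq → ℕ.<⇒≢ Ga<Gb (cong (λ x → toℕ (G ⟨$⟩ʳ x)) eq))
    ... | inj₁ Fa<Fb = word-⊑⁻ T V F le Fa<Fb Tb<Ta
    ... | inj₂ Fb<Fa with disagree⇒free {F = F} {G} stF stG Fb<Fa Ga<Gb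
    ...   | inj₁ (_ , _ , _ , a<b) = contradiction (immT a<b) (ℕ.<-asym Tb<Ta)
    ...   | inj₂ (_ , _ , _ , b<a) = immV b<a

  -- In a free pair the first cell of the row of the larger one lies strictly
  -- in between, so the entries of a free pair are never consecutive.
  transport-asc : (T F G : Permutation′ (suc m)) → Standard F → Standard G → Immaculate T →
                  ∀ {e} → Asc (T · flip F) e → Asc (T · flip G) e
  transport-asc T F G stF stG imm {e} asc = go (<-or-> G (λ eq → ℕ.<⇒≢ asc (cong (λ x → toℕ (F ⟨$⟩ʳ x)) eq)))
    where
    x y : Cell′
    x = T ⟨$⟩ˡ lower e
    y = T ⟨$⟩ˡ upper e
    Tx<Ty : (T ⟨$⟩ʳ x) Fin.< (T ⟨$⟩ʳ y)
    Tx<Ty = subst₂ Fin._<_ (sym (inverseʳ T)) (sym (inverseʳ T)) (lower<upper e)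
    go : (G ⟨$⟩ʳ x) Fin.< (G ⟨$⟩ʳ y) ⊎ (G ⟨$⟩ʳ y) Fin.< (G ⟨$⟩ʳ x) → (G ⟨$⟩ʳ x) Fin.< (G ⟨$⟩ʳ y)
    go (inj₁ lt) = lt
    go (inj₂ gt) with disagree⇒free {F = G} {F} stG stF gt asc
    ... | inj₂ (_ , _ , _ , y<x) = contradiction (imm y<x) (ℕ.<-asym Tx<Ty)
    ... | inj₁ (lt , c , c′ , _) with t , rt , ct ← row-start y = contradiction
          (ℕ.<-≤-trans
            (subst (Fin._< (T ⟨$⟩ʳ t)) (inverseʳ T) (imm {x} {t} (row-< (subst (row x <_) (sym rt) lt) , inj₂ c)))
            (<upper⇒≤lower e (subst ((T ⟨$⟩ʳ t) Fin.<_) (inverseʳ T) (imm {t} {y} (t<y , inj₁ rt)))))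
          (ℕ.<-irrefl refl)
      where
      t<y : t Fin.< y
      t<y with Fin.<-cmp t y
      ... | tri< lt _ _ = lt
      ... | tri≈ _ refl _ = contradiction ct c′
      ... | tri> _ _ gt = contradiction (column-mono gt (sym rt)) (subst (λ z → ¬ column y < z) (sym ct) λ ())

  -- F sends a cell to its place in the reading order, so σ · F is the tableau
  -- whose word is σ.
  Words : Permutation′ (suc m) → Pred (Permutation′ (suc m)) 0ℓ
  Words F σ = Immaculate (σ · F)

  -- Take `i <D j`. If `F` reads `j` first, the pair is an inversion of `σ`, which `τ` inherits; if
  -- `F` reads `i` first, it is not an inversion of `υ`, hence not of `τ`.
  Words-convex : (F : Permutation′ (suc m)) → Convex (Words F)
  Words-convex F {σ} {τ} {υ} immσ immυ σ⊑τ τ⊑υ {i} {j} i<j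
    with <-or-> {i} {j} F (λ eq → ℕ.<⇒≢ (proj₁ i<j) (cong toℕ eq))
  ... | inj₂ Fj<Fi = proj₂ (σ⊑τ (Fj<Fi , immσ i<j))
  ... | inj₁ Fi<Fj with <-or-> τ (λ eq → ℕ.<⇒≢ Fi<Fj (cong toℕ eq))
  ...   | inj₁ lt = lt
  ...   | inj₂ gt = contradiction (proj₂ (τ⊑υ (Fi<Fj , gt))) (ℕ.<-asym (immυ i<j))

  -- 𝒯 is id and 𝒯′ is top.  Ranks break ties from right to left, so 𝒯′, whose
  -- rows are filled from left to right, is obtained by reversing a rank.
  RB-key RB1-key top-key : Cell′ → ℕ
  RB-key = row
  RB1-key i with column i
  ... | zero  = bound + row i
  ... | suc _ = row i
  top-key i with column i
  -- `w₀` reverses the key: the first column must come first and bottom to top, so its keys are the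
  -- largest and decrease with the row. Rows are below `bound`, so nothing is truncated.
  ... | zero  = bound + (bound ∸ row i)
  ... | suc _ = row i

  RB-filling RB1-filling : Permutation′ (suc m)
  RB-filling = rank RB-key
  RB1-filling = rank RB1-key

  top : Permutation′ (suc m)
  top = w₀ · rank top-key

  RB1-key-first : column i ≡ 0 → RB1-key i ≡ bound + row i
  RB1-key-first {i} eq with zero ← column i = refl

  RB1-key-other : column i ≢ 0 → RB1-key i ≡ row i
  RB1-key-other {i} ≢0 with column i
  ... | zero = contradiction refl ≢0
  ... | suc _ = refl

  top-key-first : column i ≡ 0 → top-key i ≡ bound + (bound ∸ row i)
  top-key-first {i} eq with zero ← column i = refl

  top-key-other : column i ≢ 0 → top-key i ≡ row i
  top-key-other {i} ≢0 with column i
  ... | zero = contradiction refl ≢0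
  ... | suc _ = refl

  RB-standard : Standard RB-filling
  RB-standard (inj₁ (eq , lt)) = rank-mono RB-key (inj₂ (eq , lt))
  RB-standard (inj₂ (lt , _)) = rank-mono RB-key (inj₁ lt)

  RB1-other-first : column i ≢ 0 → column j ≡ 0 → RB1-key i < RB1-key j
  RB1-other-first {i} {j} ≢0 ≡0 = subst₂ _<_ (sym (RB1-key-other ≢0)) (sym (RB1-key-first ≡0))
    (ℕ.<-≤-trans (row≤bound i) (ℕ.m≤m+n bound (row j)))

  RB1-standard : Standard RB1-filling
  RB1-standard {i} {j} (inj₁ (eq , j<i)) = rank-mono RB1-key (go (column i ℕ.≟ 0) (column j ℕ.≟ 0))
    where
    ≢0 : column i ≢ 0
    ≢0 ≡0 = contradiction (column-mono j<i (sym eq)) (subst (λ z → ¬ column j < z) (sym ≡0) λ ())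
    go : Dec (column i ≡ 0) → Dec (column j ≡ 0) → Rank._≺_ RB1-key i j
    go (yes ≡0) _ = contradiction ≡0 ≢0
    go (no _) (yes ≡0′) = inj₁ (RB1-other-first ≢0 ≡0′)
    go (no _) (no ≢0′) = inj₂ (trans (RB1-key-other ≢0) (trans eq (sym (RB1-key-other ≢0′))) , j<i)
  RB1-standard {i} {j} (inj₂ (lt , c)) = rank-mono RB1-key (inj₁ (go (column i ℕ.≟ 0) (column j ℕ.≟ 0) c))
    where
    go : Dec (column i ≡ 0) → Dec (column j ≡ 0) → column i ≢ 0 ⊎ column j ≡ 0 → RB1-key i < RB1-key j
    go (yes ≡0) (yes ≡0′) _ = subst₂ _<_ (sym (RB1-key-first ≡0)) (sym (RB1-key-first ≡0′)) (ℕ.+-monoʳ-< bound lt)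
    go (no ≢0) (yes ≡0′) _ = RB1-other-first ≢0 ≡0′
    go (no ≢0) (no ≢0′) _ = subst₂ _<_ (sym (RB1-key-other ≢0)) (sym (RB1-key-other ≢0′)) lt
    go (yes ≡0) (no ≢0′) (inj₁ ≢0) = contradiction ≡0 ≢0
    go (yes ≡0) (no ≢0′) (inj₂ ≡0′) = contradiction ≡0′ ≢0′

  top-< : Rank._≺_ top-key j i → (top ⟨$⟩ʳ i) Fin.< (top ⟨$⟩ʳ j)
  top-< lt = w₀-anti (rank-mono top-key lt)

  top-first-first : row i < row j → column i ≡ 0 → column j ≡ 0 → (top ⟨$⟩ʳ i) Fin.< (top ⟨$⟩ʳ j)
  top-first-first {i} {j} lt c c′ = top-< (inj₁ (subst₂ _<_ (sym (top-key-first c′)) (sym (top-key-first c))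
    (ℕ.+-monoʳ-< bound (ℕ.∸-monoʳ-< lt (ℕ.<⇒≤ (row≤bound j))))))

  top-first-other : column i ≡ 0 → column j ≢ 0 → (top ⟨$⟩ʳ i) Fin.< (top ⟨$⟩ʳ j)
  top-first-other {i} {j} c c′ = top-< (inj₁ (subst₂ _<_ (sym (top-key-other c′)) (sym (top-key-first c))
    (ℕ.<-≤-trans (row≤bound j) (ℕ.m≤m+n bound _))))

  top-other-other : row i < row j → column i ≢ 0 → column j ≢ 0 → (top ⟨$⟩ʳ j) Fin.< (top ⟨$⟩ʳ i)
  top-other-other {i} {j} lt c c′ = top-< (inj₁ (subst₂ _<_ (sym (top-key-other c)) (sym (top-key-other c′)) lt))

  top-same : row i ≡ row j → i Fin.< j → column i ≢ 0 → column j ≢ 0 → (top ⟨$⟩ʳ i) Fin.< (top ⟨$⟩ʳ j)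
  top-same eq i<j c c′ = top-< (inj₂ (trans (top-key-other c′) (trans (sym eq) (sym (top-key-other c))) , i<j))

  -- Every pair incomparable in 𝒟 is ordered in 𝒯′ oppositely to 𝒯; this makes 𝒯′ the greatest
  -- tableau.
  top-cross : row i < row j → column i ≢ 0 → (top ⟨$⟩ʳ j) Fin.< (top ⟨$⟩ʳ i)
  top-cross {i} {j} lt c with column j ℕ.≟ 0
  ... | yes c′ = top-first-other c′ c
  ... | no c′ = top-other-other lt c c′

  -- The interval of words along a standard filling

  id-immaculate : Immaculate id
  id-immaculate = proj₁

  later-column : i Fin.< j → row i ≡ row j → column j ≢ 0
  later-column {i} {j} i<j eq ≡0 = contradiction (column-mono i<j eq) (subst (λ z → ¬ column i < z) (sym ≡0) λ ())

  top-immaculate : Immaculate top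
  top-immaculate {i} {j} (i<j , _) with column i ℕ.≟ 0 | column j ℕ.≟ 0
  top-immaculate {i} {j} (i<j , _) | yes c | no c′ = top-first-other c c′
  top-immaculate {i} {j} (i<j , _) | yes c | yes c′ with ℕ.m≤n⇒m<n∨m≡n (row-mono i<j)
  ... | inj₁ lt = top-first-first lt c c′
  ... | inj₂ eq = contradiction c′ (later-column i<j eq)
  top-immaculate {i} {j} (i<j , inj₁ eq) | no c | _ = top-same eq i<j c (later-column i<j eq)
  top-immaculate {i} {j} (i<j , inj₂ c) | no c′ | _ = contradiction c c′

  -- `T` agrees with 𝒯 on pairs comparable in `<D`. On the remaining `cross` pairs `F` itself agrees
  -- with 𝒯, so 𝒯 has no inversion there.
  lowest : (T F : Permutation′ (suc m)) → Standard F → Immaculate T → flip F ⊑ T · flip F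
  lowest T F st imm = word-⊑ id T F step′
    where
    step′ : ∀ {a b} → (F ⟨$⟩ʳ a) Fin.< (F ⟨$⟩ʳ b) → b Fin.< a → (T ⟨$⟩ʳ b) Fin.< (T ⟨$⟩ʳ a)
    step′ Fa<Fb b<a with kind b<a
    ... | same _ d _ = imm d
    ... | both _ _ _ d _ = imm d
    ... | free _ _ _ d = imm d
    ... | cross _ _ x = contradiction (st x) (ℕ.<-asym Fa<Fb)

  -- An inversion of `T` on cells numbered in reading order can only be a `cross` pair, and 𝒯′
  -- reverses all of those. On cells numbered against reading order the pair is comparable in `<D`,
  -- where all tableaux agree.
  highest : (T F : Permutation′ (suc m)) → Standard F → Immaculate T → T · flip F ⊑ top · flip F
  highest T F st imm = word-⊑ T top F step′
    where
    step′ : ∀ {a b} → (F ⟨$⟩ʳ a) Fin.< (F ⟨$⟩ʳ b) → (T ⟨$⟩ʳ b) Fin.< (T ⟨$⟩ʳ a) → (top ⟨$⟩ʳ b) Fin.< (top ⟨$⟩ʳ a)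
    step′ {a} {b} Fa<Fb Tb<Ta with Fin.<-cmp a b
    ... | tri≈ _ refl _ = contradiction Fa<Fb (ℕ.<-irrefl refl)
    ... | tri< a<b _ _ with kind a<b
    ...   | same _ d _ = contradiction (imm d) (ℕ.<-asym Tb<Ta)
    ...   | both _ _ _ d _ = contradiction (imm d) (ℕ.<-asym Tb<Ta)
    ...   | free _ _ _ d = contradiction (imm d) (ℕ.<-asym Tb<Ta)
    ...   | cross lt c _ = top-cross lt c
    step′ {a} {b} Fa<Fb Tb<Ta | tri> _ _ b<a with kind b<a
    ...   | same _ d _ = top-immaculate d
    ...   | both _ _ _ d _ = top-immaculate d
    ...   | free _ _ _ d = top-immaculate d
    ...   | cross _ _ x = contradiction (st x) (ℕ.<-asym Fa<Fb)

  interval : (F : Permutation′ (suc m)) → Standard F → Interval m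
  interval F st = record
    { lo = flip F
    ; hi = top · flip F
    ; lo⪯hi = ⊑⇒⪯L (flip F) (top · flip F) (lowest top F st top-immaculate)
    }

  unflip : (σ F : Permutation′ (suc m)) → (σ · F) · flip F ≈ σ
  unflip σ F k = cong (σ ⟨$⟩ʳ_) (inverseʳ F)

  interval≐ : (F : Permutation′ (suc m)) (st : Standard F) → ⟦ interval F st ⟧ ≐ Words F
  interval≐ F st = to , from
    where
    to : ∀ {σ} → σ ∈ ⟦ interval F st ⟧ → σ ∈ Words F
    to {σ} (lo≤ , ≤hi) = Words-convex F {flip F} {σ} {top · flip F}
      (Immaculate-resp {T = id} {flip F · F} (λ k → sym (inverseˡ F)) id-immaculate)
      (Immaculate-resp {T = top} {(top · flip F) · F} (λ k → cong (top ⟨$⟩ʳ_) (sym (inverseˡ F))) top-immaculate)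
      (⪯L⇒⊑ lo≤) (⪯L⇒⊑ ≤hi)
    from : ∀ {σ} → σ ∈ Words F → σ ∈ ⟦ interval F st ⟧
    from {σ} imm =
      ⊑⇒⪯L (flip F) σ (λ inv → ≈⇒⊑ {σ = (σ · F) · flip F} {σ} (unflip σ F) (lowest (σ · F) F st imm inv)) ,
      ⊑⇒⪯L σ (top · flip F) (λ inv → highest (σ · F) F st imm
        (≈⇒⊑ {σ = σ} {(σ · F) · flip F} (≈-sym {σ = (σ · F) · flip F} {σ} (unflip σ F)) inv))

  -- The intervals equivalent to the set of reading words

  module Class (W : Pred (Permutation′ (suc m)) 0ℓ) (W≐ : W ≐ Words RB-filling) where

    W-convex : Convex W
    W-convex {σ} {τ} {υ} σ∈ υ∈ σ⊑τ τ⊑υ =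
      proj₂ W≐ {τ} (Words-convex RB-filling {σ} {τ} {υ} (proj₁ W≐ {σ} σ∈) (proj₁ W≐ {υ} υ∈) σ⊑τ τ⊑υ)

    Words⇒W : (T : Permutation′ (suc m)) → Immaculate T → T · flip RB-filling ∈ W
    Words⇒W T imm = proj₂ W≐ {T · flip RB-filling}
      (Immaculate-resp {T = T} {(T · flip RB-filling) · RB-filling} (λ k → cong (T ⟨$⟩ʳ_) (sym (inverseˡ RB-filling))) imm)

    module _ (F : Permutation′ (suc m)) (st : Standard F) where

      private
        J = interval F st

        J≐ : ⟦ J ⟧ ≐ Words F
        J≐ = interval≐ F st

        -- The word of the same tableau, read along `RB-filling` instead of `F`.
        re-read : Permutation′ (suc m) → Permutation′ (suc m)
        re-read σ = (σ · F) · flip RB-filling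

        re-read∈ : ∀ σ → σ ∈ ⟦ J ⟧ → re-read σ ∈ W
        re-read∈ σ σ∈ = Words⇒W (σ · F) (proj₁ J≐ {σ} σ∈)

        to : ∀ σ τ → σ ∈ ⟦ J ⟧ → τ ∈ ⟦ J ⟧ → σ ⊑ τ → re-read σ ⊑ re-read τ
        to σ τ σ∈ τ∈ le = transport-⊑ (σ · F) (τ · F) F RB-filling st RB-standard
          (proj₁ J≐ {σ} σ∈) (proj₁ J≐ {τ} τ∈)
          (λ inv → ≈⇒⊑ {σ = τ} {(τ · F) · flip F} (≈-sym {σ = (τ · F) · flip F} {τ} (unflip τ F))
            (le (≈⇒⊑ {σ = (σ · F) · flip F} {σ} (unflip σ F) inv)))

        from : ∀ σ τ → σ ∈ ⟦ J ⟧ → τ ∈ ⟦ J ⟧ → re-read σ ⊑ re-read τ → σ ⊑ τ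
        from σ τ σ∈ τ∈ le inv = ≈⇒⊑ {σ = (τ · F) · flip F} {τ} (unflip τ F)
          (transport-⊑ (σ · F) (τ · F) RB-filling F RB-standard st
            (proj₁ J≐ {σ} σ∈) (proj₁ J≐ {τ} τ∈) le
            (≈⇒⊑ {σ = σ} {(σ · F) · flip F} (≈-sym {σ = (σ · F) · flip F} {σ} (unflip σ F)) inv))

        re-read-injective : ∀ σ τ → re-read σ ≈ re-read τ → σ ≈ τ
        re-read-injective σ τ eq k = trans (sym (cancel σ)) (trans (eq _) (cancel τ))
          where
          cancel : ∀ υ → re-read υ ⟨$⟩ʳ (RB-filling ⟨$⟩ʳ (F ⟨$⟩ˡ k)) ≡ υ ⟨$⟩ʳ k
          cancel υ = trans (cong (λ x → υ ⟨$⟩ʳ (F ⟨$⟩ʳ x)) (inverseˡ RB-filling)) (cong (υ ⟨$⟩ʳ_) (inverseʳ F))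

        asc-to : ∀ σ → σ ∈ ⟦ J ⟧ → ∀ {e} → Asc σ e → Asc (re-read σ) e
        asc-to σ σ∈ asc = transport-asc (σ · F) F RB-filling st RB-standard (proj₁ J≐ {σ} σ∈)
          (subst₂ Fin._<_ (sym (inverseʳ F)) (sym (inverseʳ F)) asc)

        asc-from : ∀ σ → σ ∈ ⟦ J ⟧ → ∀ {e} → Asc (re-read σ) e → Asc σ e
        asc-from σ σ∈ asc = subst₂ Fin._<_ (inverseʳ F) (inverseʳ F)
          (transport-asc (σ · F) RB-filling F RB-standard st (proj₁ J≐ {σ} σ∈) asc)

      interval∈class : ⟦ J ⟧ ∼D W
      interval∈class = (λ (σ , σ∈) → re-read σ , re-read∈ σ σ∈) , record
        { isOrderMonomorphism = record
          { isOrderHomomorphism = record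
            { cong = λ eq k → eq _
            ; mono = λ { {σ , σ∈} {τ , τ∈} le → ⊑⇒⪯L (re-read σ) (re-read τ) (to σ τ σ∈ τ∈ (⪯L⇒⊑ le)) }
            }
          ; injective = λ { {σ , _} {τ , _} → re-read-injective σ τ }
          ; cancel = λ { {σ , σ∈} {τ , τ∈} le → ⊑⇒⪯L σ τ (from σ τ σ∈ τ∈ (⪯L⇒⊑ le)) }
          }
        ; surjective = λ (τ , τ∈) → (back τ , back∈ τ τ∈) , λ eq k → trans (eq _) (back-re-read τ k)
        }
        , λ (σ , σ∈) → (λ {e} i∈ → desc⇒∈DesL σ (desc-from σ σ∈ (∈DesL⇒desc (re-read σ) i∈)))
                     , (λ {e} i∈ → desc⇒∈DesL (re-read σ) (desc-to σ σ∈ (∈DesL⇒desc σ i∈)))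
        where
        back : Permutation′ (suc m) → Permutation′ (suc m)
        back τ = (τ · RB-filling) · flip F
        back∈ : ∀ τ → τ ∈ W → back τ ∈ ⟦ J ⟧
        back∈ τ τ∈ = proj₂ J≐ {back τ} (Immaculate-resp {T = τ · RB-filling} {back τ · F}
          (λ k → cong (λ x → τ ⟨$⟩ʳ (RB-filling ⟨$⟩ʳ x)) (sym (inverseˡ F))) (proj₁ W≐ {τ} τ∈))
        back-re-read : ∀ τ k → back τ ⟨$⟩ʳ (F ⟨$⟩ʳ (RB-filling ⟨$⟩ˡ k)) ≡ τ ⟨$⟩ʳ k
        back-re-read τ k = trans (cong (λ x → τ ⟨$⟩ʳ (RB-filling ⟨$⟩ʳ x)) (inverseˡ F)) (cong (τ ⟨$⟩ʳ_) (inverseʳ RB-filling))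
        desc-to : ∀ σ → σ ∈ ⟦ J ⟧ → ∀ {e} → Desc σ e → Desc (re-read σ) e
        desc-to σ σ∈ desc = ¬asc⇒desc (re-read σ) λ asc → ℕ.<-asym desc (asc-from σ σ∈ asc)
        desc-from : ∀ σ → σ ∈ ⟦ J ⟧ → ∀ {e} → Desc (re-read σ) e → Desc σ e
        desc-from σ σ∈ desc = ¬asc⇒desc σ λ asc → ℕ.<-asym desc (asc-to σ σ∈ asc)

    module _ (I : Interval m) (iso : ⟦ I ⟧ ∼D W) where

      private
        module R = Rigid I W W-convex iso
        module M = IsOrderIsomorphism (proj₁ (proj₂ iso))
        F₀ = RB-filling
        F′ = flip (lo I)

        preimage : (T : Permutation′ (suc m)) → Immaculate T →
                   ∃[ x ] Σ (x ∈ ⟦ I ⟧) λ x∈ → R.image x x∈ ≈ T · flip F₀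
        preimage T imm with (x , x∈) , hit ← M.surjective (T · flip F₀ , Words⇒W T imm) =
          x , x∈ , hit {x , x∈} (λ _ → refl)

        image-immaculate : ∀ σ (σ∈ : σ ∈ ⟦ I ⟧) → Immaculate (R.image σ σ∈ · F₀)
        image-immaculate σ σ∈ = proj₁ W≐ {R.image σ σ∈} (proj₂ (proj₁ iso (σ , σ∈)))

        -- An order isomorphism matches least elements, and by `lowest` the least word along `F₀` is
        -- that of 𝒯. `image-hi` is the counterpart with `highest` and 𝒯′.
        image-lo : R.image (lo I) R.lo∈ ≈ flip F₀
        image-lo with x , x∈ , eq ← preimage id id-immaculate =
          ⊑-antisym (R.image (lo I) R.lo∈) (flip F₀)
            (λ inv → ≈⇒⊑ {σ = R.image x x∈} {flip F₀} eq (⪯L⇒⊑ (M.mono {lo I , R.lo∈} {x , x∈} (proj₁ x∈)) inv))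
            (λ inv → ≈⇒⊑ {σ = (R.image (lo I) R.lo∈ · F₀) · flip F₀} {R.image (lo I) R.lo∈} (unflip (R.image (lo I) R.lo∈) F₀)
              (lowest (R.image (lo I) R.lo∈ · F₀) F₀ RB-standard (image-immaculate (lo I) R.lo∈) inv))

        image-hi : R.image (hi I) R.hi∈ ≈ top · flip F₀
        image-hi with x , x∈ , eq ← preimage top top-immaculate =
          ⊑-antisym (R.image (hi I) R.hi∈) (top · flip F₀)
            (λ inv → highest (R.image (hi I) R.hi∈ · F₀) F₀ RB-standard (image-immaculate (hi I) R.hi∈)
              (≈⇒⊑ {σ = R.image (hi I) R.hi∈} {(R.image (hi I) R.hi∈ · F₀) · flip F₀}
                (≈-sym {σ = (R.image (hi I) R.hi∈ · F₀) · flip F₀} {R.image (hi I) R.hi∈} (unflip (R.image (hi I) R.hi∈) F₀)) inv))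
            (λ inv → ⪯L⇒⊑ (M.mono {x , x∈} {hi I , R.hi∈} (proj₂ x∈))
              (≈⇒⊑ {σ = top · flip F₀} {R.image x x∈} (≈-sym {σ = R.image x x∈} {top · flip F₀} eq) inv))

        image≈′ : ∀ τ (τ∈ : τ ∈ ⟦ I ⟧) → R.image τ τ∈ ≈ (τ · F′) · flip F₀
        image≈′ τ τ∈ k = trans (R.image≈ τ τ∈ k) (cong (λ x → τ ⟨$⟩ʳ (lo I ⟨$⟩ˡ x)) (image-lo k))

        -- The isomorphism keeps the tableau and only replaces the filling `F′` by `F₀`.
        image·F₀ : ∀ τ (τ∈ : τ ∈ ⟦ I ⟧) → R.image τ τ∈ · F₀ ≈ τ · F′
        image·F₀ τ τ∈ k = trans (image≈′ τ τ∈ _) (cong (λ x → τ ⟨$⟩ʳ (lo I ⟨$⟩ˡ x)) (inverseˡ F₀))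

        hi-top : hi I · F′ ≈ top
        hi-top k = trans (sym (image·F₀ (hi I) R.hi∈ k)) (trans (image-hi _) (cong (top ⟨$⟩ʳ_) (inverseˡ F₀)))

      class-words : ⟦ I ⟧ ≐ Words F′
      class-words = into , out
        where
        into : ∀ {σ} → σ ∈ ⟦ I ⟧ → σ ∈ Words F′
        into {σ} σ∈ = Immaculate-resp {T = R.image σ σ∈ · F₀} {σ · F′} (image·F₀ σ σ∈) (image-immaculate σ σ∈)
        out : ∀ {σ} → σ ∈ Words F′ → σ ∈ ⟦ I ⟧
        out {σ} imm with x , x∈ , eq ← preimage (σ · F′) imm =
          ⊑⇒⪯L (lo I) σ (λ inv → ≈⇒⊑ {σ = x} {σ} x≈σ (⪯L⇒⊑ (proj₁ x∈) inv)) ,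
          ⊑⇒⪯L σ (hi I) (λ inv → ⪯L⇒⊑ (proj₂ x∈) (≈⇒⊑ {σ = σ} {x} (≈-sym {σ = x} {σ} x≈σ) inv))
          where
          x≈σ : x ≈ σ
          x≈σ k = trans (cong (x ⟨$⟩ʳ_) (sym (inverseˡ (lo I))))
            (trans (trans (sym (image·F₀ x x∈ _)) (trans (eq _) (cong (σ · F′ ⟨$⟩ʳ_) (inverseˡ F₀))))
              (cong (σ ⟨$⟩ʳ_) (inverseˡ (lo I))))

      private
        -- Consecutive cells of a row are read from right to left, since e is a
        -- descent of the least element.
        row-link : ∀ e → row (lower e) ≡ row (upper e) → (F′ ⟨$⟩ʳ upper e) Fin.< (F′ ⟨$⟩ʳ lower e)
        row-link e eq = ∈DesL⇒desc (lo I) (proj₁ (proj₂ (proj₂ iso) (lo I , R.lo∈))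
          (desc⇒∈DesL (R.image (lo I) R.lo∈)
            (subst₂ Fin._<_ (image-lo⁻ (upper e)) (image-lo⁻ (lower e))
              (RB-standard (inj₁ (sym eq , lower<upper e))))))
          where
          image-lo⁻ : ∀ k → F₀ ⟨$⟩ʳ k ≡ R.image (lo I) R.lo∈ ⟨$⟩ˡ k
          image-lo⁻ k = sym (flip-cong {σ = R.image (lo I) R.lo∈} {flip F₀} image-lo k)

        -- Consecutive entries of the first column of 𝒯′ are read in order, since
        -- e is not a descent of the greatest element.
        first-link : ∀ e → row (top ⟨$⟩ˡ lower e) < row (top ⟨$⟩ˡ upper e) → column (top ⟨$⟩ˡ upper e) ≡ 0 →
                     (F′ ⟨$⟩ʳ (top ⟨$⟩ˡ lower e)) Fin.< (F′ ⟨$⟩ʳ (top ⟨$⟩ˡ upper e))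
        first-link e lt c = subst₂ Fin._<_ (hi-pos (lower e)) (hi-pos (upper e))
          (∉DesL⇒asc (hi I) (λ e∈ → asc⇒∉DesL (R.image (hi I) R.hi∈)
            (subst₂ Fin._<_ (image-pos (lower e)) (image-pos (upper e)) (RB-standard (inj₂ (lt , inj₂ c))))
            (proj₂ (proj₂ (proj₂ iso) (hi I , R.hi∈)) e∈)))
          where
          hi-pos : ∀ k → hi I ⟨$⟩ˡ k ≡ F′ ⟨$⟩ʳ (top ⟨$⟩ˡ k)
          hi-pos k = from-unique (hi I) (trans (hi-top _) (inverseʳ top))
          image-pos : ∀ k → F₀ ⟨$⟩ʳ (top ⟨$⟩ˡ k) ≡ R.image (hi I) R.hi∈ ⟨$⟩ˡ k
          image-pos k = sym (from-unique (R.image (hi I) R.hi∈)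
            (trans (image-hi _) (trans (cong (top ⟨$⟩ʳ_) (inverseˡ F₀)) (inverseʳ top))))

      class-standard : Standard F′
      class-standard {i} {j} (inj₁ (eq , j<i)) =
        -- Rows increase weakly with the number of a cell, so all cells numbered between `j` and `i`
        -- lie in their common row.
        chain {R = λ x y → (F′ ⟨$⟩ʳ y) Fin.< (F′ ⟨$⟩ʳ x)} (λ lt lt′ → ℕ.<-trans lt′ lt)
          (λ e j≤ ≤i → row-link e (ℕ.≤-antisym (row-mono (lower<upper e))
            (ℕ.≤-trans (row-mono′ ≤i) (subst (_≤ row (lower e)) (sym eq) (row-mono′ j≤))))) j<i
        where
        row-mono′ : ∀ {a b} → a Fin.≤ b → row a ≤ row b
        row-mono′ a≤b with ℕ.m≤n⇒m<n∨m≡n a≤b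
        ... | inj₁ a<b = row-mono a<b
        ... | inj₂ a≡b = ℕ.≤-reflexive (cong row (toℕ-injective a≡b))
      class-standard {i} {j} (inj₂ (lt , c)) with column i ℕ.≟ 0 | c
      ... | no ≢0 | _ = ⊎-elim (<-or-> F′ (λ eq → ℕ.<⇒≢ lt (cong row eq)))
        where
        ⊎-elim : (F′ ⟨$⟩ʳ i) Fin.< (F′ ⟨$⟩ʳ j) ⊎ (F′ ⟨$⟩ʳ j) Fin.< (F′ ⟨$⟩ʳ i) → (F′ ⟨$⟩ʳ i) Fin.< (F′ ⟨$⟩ʳ j)
        ⊎-elim (inj₁ lt′) = lt′
        -- Read in the wrong order, the pair would be an inversion of `lo I`, hence of `hi I`; but
        -- the tableau of `hi I` is 𝒯′, whose entry at `j` is smaller than at `i`.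
        ⊎-elim (inj₂ gt) = contradiction (top-cross lt ≢0) (ℕ.<-asym
          (subst₂ Fin._<_ (hi-top i) (hi-top j)
            (proj₂ (⪯L⇒⊑ (lo⪯hi I) (gt , subst₂ Fin._<_ (sym (inverseʳ (lo I))) (sym (inverseʳ (lo I))) (row-< lt))))))
      ... | yes ≡0 | inj₁ ≢0 = contradiction ≡0 ≢0
      -- The chain runs over the entries of 𝒯′ from `i` to `j`. As 𝒯′ fills the first column before
      -- all else, every entry on the way lies there.
      ... | yes ≡0 | inj₂ ≡0′ = subst₂ (λ x y → (F′ ⟨$⟩ʳ x) Fin.< (F′ ⟨$⟩ʳ y)) (inverseˡ top) (inverseˡ top)
        (chain {R = λ x y → (F′ ⟨$⟩ʳ (top ⟨$⟩ˡ x)) Fin.< (F′ ⟨$⟩ʳ (top ⟨$⟩ˡ y))} ℕ.<-trans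
          (λ e _ ≤j → first-link e (rows e ≤j) (first ≤j))
          (top-first-first lt ≡0 ≡0′))
        where
        first : ∀ {v} → v Fin.≤ (top ⟨$⟩ʳ j) → column (top ⟨$⟩ˡ v) ≡ 0
        first {v} v≤ with column (top ⟨$⟩ˡ v) ℕ.≟ 0
        ... | yes eq = eq
        ... | no ≢0 = contradiction (subst ((top ⟨$⟩ʳ j) Fin.<_) (inverseʳ top) (top-first-other ≡0′ ≢0)) (ℕ.≤⇒≯ v≤)
        rows : ∀ e → upper e Fin.≤ (top ⟨$⟩ʳ j) → row (top ⟨$⟩ˡ lower e) < row (top ⟨$⟩ˡ upper e)
        rows e ≤j with ℕ.<-cmp (row (top ⟨$⟩ˡ lower e)) (row (top ⟨$⟩ˡ upper e))
        ... | tri< lt′ _ _ = lt′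
        ... | tri> _ _ gt = contradiction
              (subst₂ Fin._<_ (inverseʳ top) (inverseʳ top) (top-first-first gt (first ≤j) (first (ℕ.≤-trans (ℕ.<⇒≤ (lower<upper e)) ≤j))))
              (ℕ.<-asym (lower<upper e))
        ... | tri≈ _ eq _ with Fin.<-cmp (top ⟨$⟩ˡ lower e) (top ⟨$⟩ˡ upper e)
        ...   | tri< lt′ _ _ = contradiction (first ≤j) (later-column lt′ eq)
        ...   | tri> _ _ gt = contradiction (first (ℕ.≤-trans (ℕ.<⇒≤ (lower<upper e)) ≤j)) (later-column gt (sym eq))
        ...   | tri≈ _ eq′ _ = contradiction (to-injective (flip top) eq′) (ℕ.<⇒≢ (lower<upper e) ∘ cong toℕ)

    -- `RB-filling` inverts pairs of the same row only, and every standard filling must invert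
    -- these.
    RB-least : (J : Interval m) → ⟦ J ⟧ ∼D W → flip RB-filling ⪯R lo J
    RB-least J iso = ⊑⇒⪯R (flip RB-filling) (lo J) below
      where
      below : RB-filling ⊑ flip (lo J)
      below (i<j , lt) with rank-cancel RB-key lt
      ... | inj₁ row< = contradiction (row-mono i<j) (ℕ.<⇒≱ row<)
      ... | inj₂ (eq , _) = i<j , class-standard J iso (inj₁ (eq , i<j))

    -- A standard filling can invert only `same` and `free` pairs, and `RB1-filling` inverts all of
    -- both kinds.
    RB1-greatest : (J : Interval m) → ⟦ J ⟧ ∼D W → lo J ⪯R flip RB1-filling
    RB1-greatest J iso = ⊑⇒⪯R (lo J) (flip RB1-filling) above
      where
      above : flip (lo J) ⊑ RB1-filling
      above (i<j , lt) with kind i<j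
      ... | same _ _ x = i<j , RB1-standard x
      ... | both _ _ _ _ x = contradiction (class-standard J iso x) (ℕ.<-asym lt)
      ... | free _ c c′ _ = i<j , rank-mono RB1-key (inj₁ (RB1-other-first c′ c))
      ... | cross _ _ x = contradiction (class-standard J iso x) (ℕ.<-asym lt)

  -- The greatest element of the maximal interval

  module _ {k : ℕ} (count : ∣ subsetOf (λ i → ¬? (column i ℕ.≟ 0)) ∣ ≡ k) where

    private
      C? = λ i → ¬? (column i ℕ.≟ 0)
      open Rank RB1-key using (below; ≺?)
      -- The key is injective below `k` and constant from `k` on, so `v` fixes the first `k`
      -- positions and reverses the rest.
      v : Permutation′ (suc m)
      v = rank (λ i → toℕ i ⊓ k)

    RB1-rank : ∀ a → toℕ (RB1-filling ⟨$⟩ʳ a) ≡ ∣ below a ∣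
    RB1-rank = Rank.toℕ-rank RB1-key

    -- The `k` cells off the first column are read before it, so they fill exactly the first `k`
    -- places; `RB1-first≥` is the other half.
    RB1-other< : column a ≢ 0 → toℕ (RB1-filling ⟨$⟩ʳ a) < k
    RB1-other< {a} ≢0 = subst₂ _<_ (sym (RB1-rank a)) count (p⊂q⇒∣p∣<∣q∣
      ( (λ {x} x∈ → ∈subsetOf⁺ C? λ ≡0 → Rank.≺-irrefl RB1-key
          (Rank.≺-trans RB1-key (∈subsetOf⁻ (λ x → ≺? x a) x∈) (inj₁ (RB1-other-first ≢0 ≡0))))
      , a , ∈subsetOf⁺ C? ≢0 , λ a∈ → Rank.≺-irrefl RB1-key (∈subsetOf⁻ (λ x → ≺? x a) a∈)))

    RB1-first≥ : column a ≡ 0 → k ≤ toℕ (RB1-filling ⟨$⟩ʳ a)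
    RB1-first≥ {a} ≡0 = subst₂ _≤_ count (sym (RB1-rank a)) (p⊆q⇒∣p∣≤∣q∣
      λ x∈ → ∈subsetOf⁺ (λ x → ≺? x a) (inj₁ (RB1-other-first (∈subsetOf⁻ C? x∈) ≡0)))

    -- Both words invert exactly the pairs `p < q` with `p < k`. Off the first column `RB1` reads 𝒯′
    -- backwards, and then it reads the first column forwards.
    top-RB1 : top · flip RB1-filling ≈ w₀ · v
    top-RB1 = ⊑-antisym (top · flip RB1-filling) (w₀ · v) to from
      where
      key-< : ∀ {p q : Fin (suc m)} → p Fin.< q → toℕ p < k → toℕ p ⊓ k < toℕ q ⊓ k
      key-< {p} {q} p<q p<k = subst (_< toℕ q ⊓ k) (sym (ℕ.m≤n⇒m⊓n≡m (ℕ.<⇒≤ p<k))) (ℕ.⊓-pres-m< p<q p<k)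
      to : top · flip RB1-filling ⊑ w₀ · v
      to {p} {q} (p<q , lt) = p<q , w₀-anti (rank-mono (λ i → toℕ i ⊓ k) (inj₁ (key-< p<q p<k)))
        where
        p<k : toℕ p < k
        p<k with column (RB1-filling ⟨$⟩ˡ p) ℕ.≟ 0
        ... | no ≢0 = subst (λ x → toℕ x < k) (inverseʳ RB1-filling) (RB1-other< ≢0)
        ... | yes ≡0 with column (RB1-filling ⟨$⟩ˡ q) ℕ.≟ 0
        ...   | no ≢0′ = contradiction lt (ℕ.<-asym (top-first-other ≡0 ≢0′))
        ...   | yes ≡0′ = contradiction lt (ℕ.<-asym (top-first-first rows ≡0 ≡0′))
          where
          rows : row (RB1-filling ⟨$⟩ˡ p) < row (RB1-filling ⟨$⟩ˡ q)
          rows with ℕ.<-cmp (row (RB1-filling ⟨$⟩ˡ p)) (row (RB1-filling ⟨$⟩ˡ q))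
          ... | tri< l _ _ = l
          ... | tri> _ _ g = contradiction p<q (ℕ.<-asym (subst₂ Fin._<_ (inverseʳ RB1-filling) (inverseʳ RB1-filling)
                  (RB1-standard (inj₂ (g , inj₂ ≡0)))))
          ... | tri≈ _ eq _ with Fin.<-cmp (RB1-filling ⟨$⟩ˡ p) (RB1-filling ⟨$⟩ˡ q)
          ...   | tri< l _ _ = contradiction ≡0′ (later-column l eq)
          ...   | tri> _ _ g = contradiction ≡0 (later-column g (sym eq))
          ...   | tri≈ _ e _ = contradiction (to-injective (flip RB1-filling) e) (ℕ.<⇒≢ p<q ∘ cong toℕ)
      from : w₀ · v ⊑ top · flip RB1-filling
      from {p} {q} (p<q , lt) = p<q , go (column y ℕ.≟ 0)
        where
        x y : Cell′
        x = RB1-filling ⟨$⟩ˡ p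
        y = RB1-filling ⟨$⟩ˡ q
        p<k : toℕ p < k
        p<k with rank-cancel (λ i → toℕ i ⊓ k) {p} {q} (w₀-anti⁻ lt)
        ... | inj₂ (_ , q<p) = contradiction p<q (ℕ.<-asym q<p)
        ... | inj₁ l = ℕ.≰⇒> λ k≤p → ℕ.<-irrefl (trans (ℕ.m≥n⇒m⊓n≡n k≤p)
                (sym (ℕ.m≥n⇒m⊓n≡n (ℕ.≤-trans k≤p (ℕ.<⇒≤ p<q))))) l
        ≢0 : column x ≢ 0
        ≢0 ≡0 = ℕ.<⇒≱ p<k (subst (λ z → k ≤ toℕ z) (inverseʳ RB1-filling) (RB1-first≥ ≡0))
        go : Dec (column y ≡ 0) → (top ⟨$⟩ʳ y) Fin.< (top ⟨$⟩ʳ x)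
        go (yes ≡0) = top-first-other ≡0 ≢0
        go (no ≢0′) with rank-cancel RB1-key {x} {y} (subst₂ Fin._<_ (sym (inverseʳ RB1-filling)) (sym (inverseʳ RB1-filling)) p<q)
        ... | inj₁ l = top-cross (subst₂ _<_ (RB1-key-other ≢0) (RB1-key-other ≢0′) l) ≢0
        ... | inj₂ (eq , y<x) = top-same (trans (sym (RB1-key-other ≢0′)) (trans (sym eq) (RB1-key-other ≢0))) y<x ≢0′ ≢0

    top-RB1-longest : (S : Pred (Fin m) 0ℓ) → (∀ {i} → S i → k ≤ toℕ i) → (∀ {i} → k ≤ toℕ i → S i) →
                      ∃[ u ] ∃[ z ] (Is-w₀ u × IsLongest ⟨ S ⟩ z × top · flip RB1-filling ≈ u · z)
    top-RB1-longest S S⇒ ⇒S = w₀ , v , w₀-longest ,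
      rank-longest (λ i → toℕ i ⊓ k) (λ i<j → ℕ.⊓-mono-≤ (ℕ.<⇒≤ i<j) ℕ.≤-refl) S tie untie , top-RB1
      where
      tie : ∀ {i} → S i → toℕ (lower i) ⊓ k ≡ toℕ (upper i) ⊓ k
      tie {i} i∈ = trans (ℕ.m≥n⇒m⊓n≡n (subst (k ≤_) (sym (toℕ-inject₁ i)) (S⇒ i∈)))
        (sym (ℕ.m≥n⇒m⊓n≡n (ℕ.m≤n⇒m≤1+n (S⇒ i∈))))
      untie : ∀ {i} → toℕ (lower i) ⊓ k ≡ toℕ (upper i) ⊓ k → S i
      untie {i} eq with k ℕ.≤? toℕ i
      ... | yes k≤i = ⇒S k≤i
      ... | no k≰i = contradiction eq (ℕ.<⇒≢ (subst (λ z → z ⊓ k < suc (toℕ i) ⊓ k) (sym (toℕ-inject₁ i))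
            (subst₂ _<_ (sym (ℕ.m≤n⇒m⊓n≡m (ℕ.<⇒≤ (ℕ.≰⇒> k≰i)))) (sym (ℕ.m≤n⇒m⊓n≡m (ℕ.≰⇒> k≰i))) (ℕ.n<1+n (toℕ i)))))

-- Cells of a composition

locate : ∀ as i → i < sum as →
         ∃[ x ] ∃[ j ] (j < lookup as x × i ≡ sum (take (toℕ x) as) + j)
locate (a ∷ as) i i< with i ℕ.<? a
... | yes i<a = zero , i , i<a , refl
... | no i≮a with x , j , j< , eq ← locate as (i ∸ a) (ℕ.+-cancelˡ-< a _ _
        (subst (_< a + sum as) (sym (ℕ.m+[n∸m]≡n (ℕ.≮⇒≥ i≮a))) i<)) =
  suc x , j , j< , trans (sym (ℕ.m+[n∸m]≡n (ℕ.≮⇒≥ i≮a)))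
    (trans (cong (a +_) eq) (sym (ℕ.+-assoc a _ j)))

take-step : ∀ as (x : Fin (length as)) y → toℕ x < y → sum (take (toℕ x) as) + lookup as x ≤ sum (take y as)
take-step (a ∷ as) zero (suc y) _ = ℕ.m≤m+n a _
take-step (a ∷ as) (suc x) (suc y) (s≤s x<y) = ℕ.≤-trans
  (ℕ.≤-reflexive (ℕ.+-assoc a _ _)) (ℕ.+-monoʳ-≤ a (take-step as x y x<y))

take-total : ∀ as (x : Fin (length as)) → sum (take (toℕ x) as) + lookup as x ≤ sum as
take-total (a ∷ as) zero = ℕ.m≤m+n a _
take-total (a ∷ as) (suc x) = ℕ.≤-trans (ℕ.≤-reflexive (ℕ.+-assoc a _ _)) (ℕ.+-monoʳ-≤ a (take-total as x))

take-mono : ∀ as {x y} → x ≤ y → sum (take x as) ≤ sum (take y as)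
take-mono as {zero} _ = z≤n
take-mono [] {suc x} {suc y} _ = z≤n
take-mono (a ∷ as) {suc x} {suc y} (s≤s le) = ℕ.+-monoʳ-≤ a (take-mono as le)

pred-lookup≤ : ∀ as (x : Fin (length as)) → pred (lookup as x) ≤ sum (map pred as)
pred-lookup≤ (a ∷ as) zero = ℕ.m≤m+n (pred a) _
pred-lookup≤ (a ∷ as) (suc x) = ℕ.≤-trans (pred-lookup≤ as x) (ℕ.m≤n+m _ (pred a))

-- The sum for `x` includes the terms of `y` and of all rows after `y`. Hence, above the bottom row
-- of 𝒟, the boxes from row `y` stay below those from row `x`.
shift-step : ∀ as (x y : Fin (length as)) → x Fin.< y →
             pred (lookup as y) + sum (map pred (drop (suc (toℕ y)) as)) ≤ sum (map pred (drop (suc (toℕ x)) as))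
shift-step (a ∷ as) zero (suc y) _ = go as y
  where
  go : ∀ as (y : Fin (length as)) →
       pred (lookup as y) + sum (map pred (drop (suc (toℕ y)) as)) ≤ sum (map pred as)
  go (a ∷ as) zero = ℕ.≤-refl
  go (a ∷ as) (suc y) = ℕ.≤-trans (go as y) (ℕ.m≤n+m _ (pred a))
shift-step (a ∷ as) (suc x) (suc y) (s≤s x<y) = shift-step as x y x<y

module Coordinates {n : ℕ} (α : Composition n) where

  private
    as = parts α
    located : (i : Fin n) → _
    located i = locate as (toℕ i) (subst (toℕ i <_) (sym (sums α)) (Fin.toℕ<n i))

    off : ℕ → ℕ
    off x = sum (take x as)

  rowIx : Fin n → Fin (ℓ α)
  rowIx i = proj₁ (located i)

  columnOf rowOf : Fin n → ℕ
  columnOf i = proj₁ (proj₂ (located i))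
  rowOf i = toℕ (rowIx i)

  column< : ∀ i → columnOf i < part α (rowIx i)
  column< i = proj₁ (proj₂ (proj₂ (located i)))

  index-formula : ∀ i → toℕ i ≡ off (rowOf i) + columnOf i
  index-formula i = proj₂ (proj₂ (proj₂ (located i)))

  private
    end : ∀ i {y} → rowOf i < y → toℕ i < off y
    end i {y} lt = subst (_< off y) (sym (index-formula i))
      (ℕ.<-≤-trans (ℕ.+-monoʳ-< (off (rowOf i)) (column< i)) (take-step as (rowIx i) y lt))

    start : ∀ i → off (rowOf i) ≤ toℕ i
    start i = subst (off (rowOf i) ≤_) (sym (index-formula i)) (ℕ.m≤m+n _ _)

  row-mono : ∀ {i j} → i Fin.< j → rowOf i ≤ rowOf j
  row-mono {i} {j} i<j = ℕ.≮⇒≥ λ lt → ℕ.<-asym i<j (ℕ.<-≤-trans (end j lt) (start i))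

  column-mono : ∀ {i j} → i Fin.< j → rowOf i ≡ rowOf j → columnOf i < columnOf j
  column-mono {i} {j} i<j eq = ℕ.+-cancelˡ-< (off (rowOf i)) _ _
    (subst₂ _<_ (index-formula i) (trans (index-formula j) (cong (λ x → off x + columnOf j) (sym eq))) i<j)

  column-cancel : ∀ {i j} → rowOf i ≡ rowOf j → columnOf i < columnOf j → i Fin.< j
  column-cancel {i} {j} eq lt = subst₂ _<_ (sym (index-formula i))
    (sym (trans (index-formula j) (cong (λ x → off x + columnOf j) (sym eq))))
    (ℕ.+-monoʳ-< (off (rowOf i)) lt)

  coordinates-injective : ∀ {i j} → rowOf i ≡ rowOf j → columnOf i ≡ columnOf j → i ≡ j
  coordinates-injective {i} {j} eq eq′ = toℕ-injective
    (trans (index-formula i) (trans (cong₂ (λ x y → off x + y) eq eq′) (sym (index-formula j))))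

  cell : (x : Fin (ℓ α)) (j : ℕ) → j < part α x → ∃[ i ] (rowIx i ≡ x × columnOf i ≡ j)
  cell x j j< = i , row≡ , ℕ.+-cancelˡ-≡ (off (toℕ x)) _ _
      (trans (cong (λ z → off (toℕ z) + columnOf i) (sym row≡)) (trans (sym (index-formula i)) i≡))
    where
    i< : off (toℕ x) + j < n
    i< = subst (off (toℕ x) + j <_) (sums α) (ℕ.<-≤-trans (ℕ.+-monoʳ-< (off (toℕ x)) j<) (take-total as x))
    i : Fin n
    i = Fin.fromℕ< i<
    i≡ : toℕ i ≡ off (toℕ x) + j
    i≡ = Fin.toℕ-fromℕ< i<
    row≡ : rowIx i ≡ x
    row≡ with Fin.<-cmp (rowIx i) x
    ... | tri≈ _ eq _ = eq
    ... | tri< lt _ _ = contradiction (end i lt) (ℕ.≤⇒≯ (ℕ.≤-trans (ℕ.m≤m+n _ j) (ℕ.≤-reflexive (sym i≡))))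
    ... | tri> _ _ gt = contradiction
          (ℕ.<-≤-trans (ℕ.+-monoʳ-< (off (toℕ x)) j<)
            (ℕ.≤-trans (take-step as x (rowOf i) gt) (start i)))
          (ℕ.<-irrefl (sym i≡))

  row-start : ∀ i → ∃[ t ] (rowOf t ≡ rowOf i × columnOf t ≡ 0)
  row-start i with t , eq , eq′ ← cell (rowIx i) 0 (ℕ.≤-<-trans z≤n (column< i)) = t , cong toℕ eq , eq′

  first-cell : ∀ x → ∃[ t ] (rowIx t ≡ x × columnOf t ≡ 0)
  first-cell x = cell x 0 (All.lookup (positive α) (∈-lookup x))

  row<ℓ : ∀ i → rowOf i < ℓ α
  row<ℓ i = Fin.toℕ<n (rowIx i)

  -- After a change of row `j` is the first cell of its row, and its number is the partial sum of
  -- the parts before that row.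
  jump⇒ : ∀ {i j} → toℕ j ≡ suc (toℕ i) → rowOf i ≢ rowOf j →
          ∃[ k ] (1 ≤ k × k < ℓ α × toℕ j ≡ sum (take k as))
  jump⇒ {i} {j} eq ≢ = rowOf j , ℕ.≤-<-trans z≤n lt , row<ℓ j ,
    ℕ.≤-antisym (subst (_≤ off (rowOf j)) (sym eq) (end i lt)) (start j)
    where
    lt : rowOf i < rowOf j
    lt = ℕ.≤∧≢⇒< (row-mono (subst (toℕ i <_) (sym eq) ℕ.≤-refl)) ≢

  ⇒jump : ∀ {i j} → toℕ j ≡ suc (toℕ i) → ∃[ k ] (1 ≤ k × k < ℓ α × toℕ j ≡ sum (take k as)) → rowOf i ≢ rowOf j
  ⇒jump {i} {j} eq (k , _ , _ , eq′) same with k ℕ.≤? rowOf i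
  ... | yes k≤ = contradiction (ℕ.≤-trans (take-mono as k≤) (start i))
          (ℕ.<⇒≱ (subst (toℕ i <_) (trans (sym eq) eq′) ℕ.≤-refl))
  ... | no k≰ = contradiction (end j (subst (_< k) same (ℕ.≰⇒> k≰))) (ℕ.<-irrefl eq′)

  others : Subset n
  others = subsetOf (λ i → ¬? (columnOf i ℕ.≟ 0))

-- Cardinality of a subset of Fin n listed without repetition

∣∣-listed : ∀ {l} (p : Subset n) (t : Fin l → Fin n) → (∀ {x y} → t x ≡ t y → x ≡ y) →
            (∀ x → t x Subset.∈ p) → (∀ {i} → i Subset.∈ p → ∃[ x ] t x ≡ i) → ∣ p ∣ ≡ l
∣∣-listed {n} {zero} p t inj t∈ onto = ℕ.n≤0⇒n≡0 (subst (∣ p ∣ ≤_) (∣⊥∣≡0 n)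
  (p⊆q⇒∣p∣≤∣q∣ {p = p} {Subset.⊥} λ i∈ → contradiction (proj₁ (onto i∈)) λ ()))
∣∣-listed {n} {suc l} p t inj t∈ onto = ℕ.≤-antisym
  (ℕ.≤-trans (∣∣-insert p′ p (t zero) keep) (s≤s (ℕ.≤-reflexive rest)))
  (subst (_< ∣ p ∣) rest (x∈p⇒∣p-x∣<∣p∣ (t∈ zero)))
  where
  p′ = p Subset.- t zero
  keep : ∀ {y} → y Subset.∈ p → y Subset.∈ p′ ⊎ y ≡ t zero
  keep {y} y∈ with y Fin.≟ t zero
  ... | yes eq = inj₂ eq
  ... | no ≢ = inj₁ (x∈p∧x≢y⇒x∈p-y y∈ ≢)
  tail-onto : ∀ {i} → i Subset.∈ p′ → ∃[ x ] t (suc x) ≡ i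
  tail-onto {i} i∈ with onto (p─q⊆p p Subset.⁅ t zero ⁆ i∈)
  ... | suc x , eq = x , eq
  ... | zero , refl = contradiction (Subset-x∉p-x p i∈) λ ()
    where
    Subset-x∉p-x : ∀ {n} (p : Subset n) {x} → x Subset.∈ p Subset.- x → Fin 0
    Subset-x∉p-x (inside ∷ p) {zero} ()
    Subset-x∉p-x (outside ∷ p) {zero} ()
    Subset-x∉p-x (_ ∷ p) {suc x} (there h) = Subset-x∉p-x p h
  rest : ∣ p′ ∣ ≡ l
  rest = ∣∣-listed p′ (λ x → t (suc x)) (λ eq → Fin.suc-injective (inj eq))
    (λ x → x∈p∧x≢y⇒x∈p-y (t∈ (suc x)) (λ eq → contradiction (inj eq) λ ())) tail-onto

-- Each row has exactly one cell in the first column, so the complement is counted.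
others-count : (α : Composition n) → ∣ Coordinates.others α ∣ ≡ n ∸ ℓ α
others-count {n} α = begin
  ∣ others ∣                ≡⟨ cong ∣_∣ others≡ ⟩
  ∣ Subset.∁ firsts ∣       ≡⟨ ∣∁p∣≡n∸∣p∣ firsts ⟩
  n ∸ ∣ firsts ∣            ≡⟨ cong (n ∸_) (∣∣-listed firsts t t-injective t∈ onto) ⟩
  n ∸ ℓ α                   ∎
  where
  open ≡-Reasoning
  open Coordinates α
  first? : Decidable (λ i → columnOf i ≡ 0)
  first? i = columnOf i ℕ.≟ 0
  firsts : Subset n
  firsts = subsetOf first?
  others≡ : others ≡ Subset.∁ firsts
  others≡ = ⊆-antisym
    (λ i∈ → x∉p⇒x∈∁p λ i∈f → ∈subsetOf⁻ (λ i → ¬? (first? i)) i∈ (∈subsetOf⁻ first? i∈f))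
    (λ i∈ → ∈subsetOf⁺ (λ i → ¬? (first? i)) λ eq → x∈∁p⇒x∉p i∈ (∈subsetOf⁺ first? eq))
  t : Fin (ℓ α) → Fin n
  t x = proj₁ (first-cell x)
  t-injective : ∀ {x y} → t x ≡ t y → x ≡ y
  t-injective {x} {y} eq = trans (sym (proj₁ (proj₂ (first-cell x))))
    (trans (cong rowIx eq) (proj₁ (proj₂ (first-cell y))))
  t∈ : ∀ x → t x Subset.∈ firsts
  t∈ x = ∈subsetOf⁺ first? (proj₂ (proj₂ (first-cell x)))
  onto : ∀ {i} → i Subset.∈ firsts → ∃[ x ] t x ≡ i
  onto {i} i∈ = rowIx i , coordinates-injective (cong toℕ (proj₁ (proj₂ (first-cell (rowIx i)))))
    (trans (proj₂ (proj₂ (first-cell (rowIx i)))) (sym (∈subsetOf⁻ first? i∈)))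

-- Fillings of an enumerated diagram

-- Numbering the boxes of `tcd α`, 𝒟 and its reflections by the same `Fin n` makes all their
-- fillings permutations of one set of cells.
record Enumeration (D : Diagram) (n : ℕ) : Set where
  field
    box : Fin n → Box
    box∈ : ∀ i → box i ∈ˡ D
    box-injective : ∀ {i j} → box i ≡ box j → i ≡ j
    box-onto : ∀ {b} → b ∈ˡ D → ∃[ i ] box i ≡ b

  index : Cell D → Fin n
  index (_ , b∈) = proj₁ (box-onto b∈)

  box-index : (c : Cell D) → box (index c) ≡ proj₁ c
  box-index (_ , b∈) = proj₂ (box-onto b∈)

  cellOf : Fin n → Cell D
  cellOf i = box i , box∈ i

  index-cellOf : ∀ i → index (cellOf i) ≡ i
  index-cellOf i = box-injective (box-index (cellOf i))

  index-cong : {c d : Cell D} → proj₁ c ≡ proj₁ d → index c ≡ index d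
  index-cong {c} {d} eq = box-injective (trans (box-index c) (trans eq (sym (box-index d))))

  fill : Permutation′ n → Filling D n
  fill π = record
    { to        = λ c → π ⟨$⟩ʳ index c
    ; from      = λ v → cellOf (π ⟨$⟩ˡ v)
    ; to-cong   = λ {c} {d} eq → cong (π ⟨$⟩ʳ_) (index-cong {c} {d} eq)
    ; from-cong = λ eq → cong (λ v → box (π ⟨$⟩ˡ v)) eq
    ; inverse   =
        (λ {v} {c} eq → to-unique π (box-injective (sym (trans (box-index c) eq))))
      , (λ {c} {v} eq → trans (cong box (from-unique π (sym eq))) (box-index c))
    }

  labels : Filling D n → Permutation′ n
  labels F = permutation (λ i → F.to (cellOf i)) (λ v → index (F.from v))
    (λ v → F.inverseˡ {v} {cellOf (index (F.from v))} (box-index (F.from v)))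
    (λ i → box-injective (trans (box-index (F.from (F.to (cellOf i)))) (F.inverseʳ {cellOf i} refl)))
    where module F = Inverse F

  box-labels : (F : Filling D n) (v : Fin n) → position F v ≡ box (labels F ⟨$⟩ˡ v)
  box-labels F v = sym (box-index (Inverse.from F v))

  entry-labels : (F : Filling D n) (c : Cell D) → entry F c ≡ labels F ⟨$⟩ʳ index c
  entry-labels F c = Inverse.to-cong F {c} {cellOf (index c)} (sym (box-index c))

  labels-fill : (π : Permutation′ n) → labels (fill π) ≈ π
  labels-fill π i = cong (π ⟨$⟩ʳ_) (index-cellOf i)

  -- `G` gives each box its place in the reading order; the word `σ` of `F` is then characterised by
  -- `σ · G ≈ labels F`.
  module _ (_≺_ : Box → Box → Set) (G : Permutation′ n) where

    reads⇒ : (∀ {i j} → box i ≺ box j → (G ⟨$⟩ʳ i) Fin.< (G ⟨$⟩ʳ j)) →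
             (F : Filling D n) (σ : Permutation′ n) → Reads _≺_ F σ → σ · G ≈ labels F
    reads⇒ mono F σ reads i = sym (to-unique (labels F) (sym (to-injective G (same (G ⟨$⟩ʳ i)))))
      where
      same : id ≈ G · (flip (labels F) · σ)
      -- The place of the box holding the `p`-th letter increases strictly with `p`, so it is `p`.
      same = same-order⇒≈ id (G · (flip (labels F) · σ)) λ {p} {q} p<q →
        mono (subst₂ _≺_ (box-labels F (σ ⟨$⟩ʳ p)) (box-labels F (σ ⟨$⟩ʳ q)) (reads p q p<q))

    ⇒reads : (∀ {i j} → (G ⟨$⟩ʳ i) Fin.< (G ⟨$⟩ʳ j) → box i ≺ box j) →
             (F : Filling D n) (σ : Permutation′ n) → σ · G ≈ labels F → Reads _≺_ F σ
    ⇒reads mono F σ eq p q p<q = subst₂ _≺_ (sym (place p)) (sym (place q))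
      (mono (subst₂ Fin._<_ (sym (inverseʳ G)) (sym (inverseʳ G)) p<q))
      where
      place : ∀ p → position F (σ ⟨$⟩ʳ p) ≡ box (G ⟨$⟩ˡ p)
      place p = trans (box-labels F (σ ⟨$⟩ʳ p)) (cong box (from-unique (labels F)
        (trans (sym (eq (G ⟨$⟩ˡ p))) (cong (σ ⟨$⟩ʳ_) (inverseʳ G)))))

flipEnumeration : {D : Diagram} → Enumeration D n → Enumeration (D ^x) n
flipEnumeration {D = D} E = record
  { box = λ i → flipBox (height D) (E.box i)
  ; box∈ = λ i → ∈-map⁺ (flipBox (height D)) (E.box∈ i)
  ; box-injective = λ {i} {j} eq → E.box-injective
      (flipBox-injective (height D) (row≤height D (E.box∈ i)) (row≤height D (E.box∈ j)) eq)
  ; box-onto = λ b∈ → onto (∈-map⁻ (flipBox (height D)) b∈)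
  }
  where
  module E = Enumeration E
  onto : ∀ {b} → ∃[ c ] (c ∈ˡ D × b ≡ flipBox (height D) c) → ∃[ i ] flipBox (height D) (E.box i) ≡ b
  onto (c , c∈ , refl) with i , refl ← E.box-onto c∈ = i , refl

flip-≤ᵇ⁺ : (D : Diagram) {b c : Box} → col b ≤ col c → row c ≤ row b →
           flipBox (height D) b ≤ᵇ flipBox (height D) c
flip-≤ᵇ⁺ D cols rows = cols , ℕ.∸-monoʳ-≤ (suc (height D)) rows

-- Truncated subtraction reverses strict inequalities only for rows up to the height, and membership
-- supplies that bound.
flip-≤ᵇ⁻ : (D : Diagram) {b c : Box} → b ∈ˡ D → c ∈ˡ D →
           flipBox (height D) b ≤ᵇ flipBox (height D) c → col b ≤ col c × row c ≤ row b
flip-≤ᵇ⁻ D {b} {c} b∈ c∈ (cols , rows) = cols , ℕ.≮⇒≥ λ lt →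
  ℕ.<⇒≱ (ℕ.∸-monoʳ-< lt (ℕ.m≤n⇒m≤1+n (row≤height D c∈))) rows

module Boxes (α : Composition n) where

  open Coordinates α

  tcd-box : Fin n → Box
  tcd-box i = suc (columnOf i) , suc (rowOf i)

  -- Columns count from 0 here, so `suc j` stands for the tableau column `j + 2`; the second
  -- argument is the shift of the row.
  𝒟-row : ℕ → ℕ → ℕ
  𝒟-row zero _ = 1
  𝒟-row (suc j) k = suc (suc j) + k

  𝒟-rowOf : Fin n → ℕ
  𝒟-rowOf i = 𝒟-row (columnOf i) (shift α (rowIx i))

  𝒟-box : Fin n → Box
  𝒟-box i = suc (rowOf i) , 𝒟-rowOf i

  tcd-enumeration : Enumeration (tcd α) n
  tcd-enumeration = record
    { box = tcd-box
    ; box∈ = λ i → ∈-concatMap⁺ line (lose (∈-allFin (rowIx i))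
        (∈-map⁺ (λ j → j , suc (rowOf i)) (∈-map⁺ suc (∈-upTo⁺ (column< i)))))
    ; box-injective = λ eq → coordinates-injective
        (ℕ.suc-injective (cong row eq)) (ℕ.suc-injective (cong col eq))
    ; box-onto = onto
    }
    where
    line : Fin (ℓ α) → List Box
    line x = map (λ j → j , suc (toℕ x)) (range 1 (part α x))
    onto : ∀ {b} → b ∈ˡ tcd α → ∃[ i ] tcd-box i ≡ b
    onto b∈ with x , _ , b∈x ← find (∈-concatMap⁻ line {xs = allFin (ℓ α)} b∈)
      with _ , j∈ , refl ← ∈-map⁻ (λ j → j , suc (toℕ x)) b∈x
      with j , j∈′ , refl ← ∈-map⁻ suc j∈
      with i , refl , refl ← cell x j (∈-upTo⁻ j∈′) = i , refl

  𝒟-row-first : ∀ {i} → columnOf i ≡ 0 → 𝒟-rowOf i ≡ 1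
  𝒟-row-first {i} eq = cong (λ j → 𝒟-row j (shift α (rowIx i))) eq

  𝒟-row-positive : ∀ i → 1 ≤ 𝒟-rowOf i
  𝒟-row-positive i with columnOf i
  ... | zero = ℕ.≤-refl
  ... | suc _ = s≤s z≤n

  𝒟-row-other : ∀ {i} → columnOf i ≢ 0 → 2 ≤ 𝒟-rowOf i
  𝒟-row-other {i} ≢0 with columnOf i
  ... | zero = contradiction refl ≢0
  ... | suc _ = s≤s (s≤s z≤n)

  𝒟-row-same : ∀ {i j} → i Fin.< j → rowOf i ≡ rowOf j → 𝒟-rowOf i < 𝒟-rowOf j
  𝒟-row-same {i} {j} i<j eq = subst (λ x → 𝒟-rowOf i < 𝒟-row (columnOf j) (shift α x)) (toℕ-injective eq)
    (go (column-mono i<j eq))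
    where
    go : ∀ {a b k} → a < b → 𝒟-row a k < 𝒟-row b k
    go {zero} {suc b} _ = s≤s (s≤s z≤n)
    go {suc a} {suc b} {k} a<b = s≤s (ℕ.+-monoˡ-< k a<b)

  𝒟-row-cross : ∀ {i j} → rowOf i < rowOf j → columnOf i ≢ 0 → 𝒟-rowOf j < 𝒟-rowOf i
  𝒟-row-cross {i} {j} lt ≢0 = go (columnOf i) (columnOf j) ≢0 (column< j)
    where
    go : ∀ a b → a ≢ 0 → b < part α (rowIx j) → 𝒟-row b (shift α (rowIx j)) < 𝒟-row a (shift α (rowIx i))
    go zero _ ≢0 _ = contradiction refl ≢0
    go (suc a) zero _ _ = s≤s (s≤s z≤n)
    go (suc a) (suc b) _ b< = s≤s (s≤s (ℕ.≤-trans
      (ℕ.+-monoˡ-≤ (shift α (rowIx j)) (ℕ.pred-mono-≤ b<))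
      (ℕ.≤-trans (shift-step (parts α) (rowIx i) (rowIx j) lt) (ℕ.m≤n+m _ a))))

  𝒟-box-injective : ∀ {i j} → 𝒟-box i ≡ 𝒟-box j → i ≡ j
  𝒟-box-injective {i} {j} eq with Fin.<-cmp i j
  ... | tri≈ _ i≡j _ = i≡j
  ... | tri< i<j _ _ = contradiction (cong row eq) (ℕ.<⇒≢ (𝒟-row-same i<j (ℕ.suc-injective (cong col eq))))
  ... | tri> _ _ j<i = contradiction (cong row (sym eq)) (ℕ.<⇒≢ (𝒟-row-same j<i (ℕ.suc-injective (cong col (sym eq)))))

  𝒟-enumeration : Enumeration (𝒟 α) n
  𝒟-enumeration = record
    { box = 𝒟-box
    ; box∈ = λ i → box∈ i (columnOf i) refl
    ; box-injective = 𝒟-box-injective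
    ; box-onto = λ b∈ → onto (∈-++⁻ bottom b∈)
    }
    where
    bottom : List Box
    bottom = map (λ x → suc (toℕ x) , 1) (allFin (ℓ α))
    stack : Fin (ℓ α) → List Box
    stack x = map (λ j → suc (toℕ x) , j + shift α x) (range 2 (part α x))
    box∈ : ∀ i j → columnOf i ≡ j → (suc (rowOf i) , 𝒟-row j (shift α (rowIx i))) ∈ˡ 𝒟 α
    box∈ i zero _ = ∈-++⁺ˡ (∈-map⁺ (λ x → suc (toℕ x) , 1) (∈-allFin (rowIx i)))
    box∈ i (suc j) eq = ∈-++⁺ʳ bottom (∈-concatMap⁺ stack (lose (∈-allFin (rowIx i))
      (∈-map⁺ (λ j → suc (rowOf i) , j + shift α (rowIx i)) (∈-map⁺ (2 +_)
        (∈-upTo⁺ (ℕ.pred-mono-≤ (subst (_< part α (rowIx i)) eq (column< i))))))))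
    suc<-pred : ∀ p {j} → j < p ∸ 1 → suc j < p
    suc<-pred (suc p) lt = s≤s lt
    onto : ∀ {b} → b ∈ˡ bottom ⊎ b ∈ˡ concatMap stack (allFin (ℓ α)) → ∃[ i ] 𝒟-box i ≡ b
    onto (inj₁ b∈) with x , _ , refl ← ∈-map⁻ (λ x → suc (toℕ x) , 1) b∈
      with i , refl , eq ← first-cell x = i , cong (suc (rowOf i) ,_) (𝒟-row-first eq)
    onto (inj₂ b∈) with x , _ , b∈x ← find (∈-concatMap⁻ stack {xs = allFin (ℓ α)} b∈)
      with _ , j∈ , refl ← ∈-map⁻ (λ j → suc (toℕ x) , j + shift α x) b∈x
      with j , j∈′ , refl ← ∈-map⁻ (2 +_) j∈
      with i , refl , eq ← cell x (suc j) (suc<-pred (part α x) (∈-upTo⁻ j∈′)) =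
        i , cong (λ c → suc (rowOf i) , 𝒟-row c (shift α (rowIx i))) eq

-- The diagram of a composition and the class of its intervals

module ClassOf {m : ℕ} (α : Composition (suc m)) where

  open Coordinates α
  open Boxes α
  open Tableaux rowOf columnOf row-mono column-mono row-start (ℓ α) row<ℓ

  private variable
    i j : Fin (suc m)

  𝒟ˣ-enumeration : Enumeration (𝒟 α ^x) (suc m)
  𝒟ˣ-enumeration = flipEnumeration 𝒟-enumeration

  𝒟ˣˣ-enumeration : Enumeration (𝒟 α ^x ^x) (suc m)
  𝒟ˣˣ-enumeration = flipEnumeration 𝒟ˣ-enumeration

  module ET = Enumeration tcd-enumeration
  module ED = Enumeration 𝒟-enumeration
  module EX = Enumeration 𝒟ˣ-enumeration
  module EXX = Enumeration 𝒟ˣˣ-enumeration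

  ≤D⇒ : 𝒟-box i ≤ᵇ 𝒟-box j → i ≡ j ⊎ i <D j
  ≤D⇒ {i} {j} (s≤s cols , rows) with Fin.<-cmp i j
  ... | tri≈ _ eq _ = inj₁ eq
  ... | tri> _ _ j<i = contradiction rows
        (ℕ.<⇒≱ (𝒟-row-same j<i (ℕ.≤-antisym (row-mono j<i) cols)))
  ... | tri< i<j _ _ with kind i<j
  ...   | same _ d _ = inj₂ d
  ...   | both _ _ _ d _ = inj₂ d
  ...   | free _ _ _ d = inj₂ d
  ...   | cross lt ≢0 _ = contradiction rows (ℕ.<⇒≱ (𝒟-row-cross lt ≢0))

  ⇒≤D : i <D j → 𝒟-box i ≤ᵇ 𝒟-box j
  ⇒≤D {i} {j} (i<j , inj₁ eq) = s≤s (row-mono i<j) , ℕ.<⇒≤ (𝒟-row-same i<j eq)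
  ⇒≤D {i} {j} (i<j , inj₂ ≡0) = s≤s (row-mono i<j) ,
    subst (_≤ 𝒟-rowOf j) (sym (𝒟-row-first ≡0)) (𝒟-row-positive j)

  ≤X⇒ : EX.box i ≤ᵇ EX.box j → i ≡ j ⊎ i <X j
  ≤X⇒ {i} {j} le with flip-≤ᵇ⁻ (𝒟 α) (ED.box∈ i) (ED.box∈ j) le
  ... | s≤s cols , rows with Fin.<-cmp i j
  ...   | tri≈ _ eq _ = inj₁ eq
  ...   | tri> _ _ j<i = inj₂ (inj₁ (ℕ.≤-antisym cols (row-mono j<i) , j<i))
  ...   | tri< i<j _ _ with kind i<j
  ...     | same eq _ _ = contradiction rows (ℕ.<⇒≱ (𝒟-row-same i<j eq))
  ...     | both _ _ _ _ x = inj₂ x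
  ...     | free _ ≡0 ≢0 _ = contradiction (subst (𝒟-rowOf j ≤_) (𝒟-row-first ≡0) rows)
              (ℕ.<⇒≱ (𝒟-row-other ≢0))
  ...     | cross _ _ x = inj₂ x

  ⇒≤X : i <X j → EX.box i ≤ᵇ EX.box j
  ⇒≤X (inj₁ (eq , j<i)) = flip-≤ᵇ⁺ (𝒟 α) (s≤s (ℕ.≤-reflexive eq)) (ℕ.<⇒≤ (𝒟-row-same j<i (sym eq)))
  ⇒≤X (inj₂ (lt , inj₁ ≢0)) = flip-≤ᵇ⁺ (𝒟 α) (s≤s (ℕ.<⇒≤ lt)) (ℕ.<⇒≤ (𝒟-row-cross lt ≢0))
  ⇒≤X {i} {j} (inj₂ (lt , inj₂ ≡0)) = flip-≤ᵇ⁺ (𝒟 α) (s≤s (ℕ.<⇒≤ lt))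
    (subst (_≤ 𝒟-rowOf i) (sym (𝒟-row-first ≡0)) (𝒟-row-positive i))

  <X⇒≢ : i <X j → i ≢ j
  <X⇒≢ (inj₁ (_ , lt)) refl = ℕ.<-irrefl refl lt
  <X⇒≢ (inj₂ (lt , _)) refl = ℕ.<-irrefl refl lt

  standard⇒ : (T : Filling (𝒟 α ^x) (suc m)) → IsStandard T → Standard (EX.labels T)
  standard⇒ T std {i} {j} lt = Fin.≤∧≢⇒< (std (EX.cellOf i) (EX.cellOf j) (⇒≤X lt))
    (λ eq → <X⇒≢ lt (to-injective (EX.labels T) eq))

  ⇒standard : (T : Filling (𝒟 α ^x) (suc m)) → Standard (EX.labels T) → IsStandard T
  ⇒standard T std b c le = subst₂ Fin._≤_ (sym (EX.entry-labels T b)) (sym (EX.entry-labels T c))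
    (weaken (≤X⇒ (subst₂ _≤ᵇ_ (sym (EX.box-index b)) (sym (EX.box-index c)) le)))
    where
    weaken : EX.index b ≡ EX.index c ⊎ EX.index b <X EX.index c →
             (EX.labels T ⟨$⟩ʳ EX.index b) Fin.≤ (EX.labels T ⟨$⟩ʳ EX.index c)
    weaken (inj₁ eq) = ℕ.≤-reflexive (cong (λ x → toℕ (EX.labels T ⟨$⟩ʳ x)) eq)
    weaken (inj₂ lt) = ℕ.<⇒≤ (std lt)

  -- The definition compares cells of one row or of the first column. Any other `i <D j` passes
  -- through the first cell of the row of `j`.
  immaculate⇒ : (T : Filling (tcd α) (suc m)) → IsImmaculate α T → Immaculate (ET.labels T)
  immaculate⇒ T (rows , first) {i} {j} (i<j , inj₁ eq) =
    rows (ET.cellOf i) (ET.cellOf j) (cong suc eq) (s≤s (column-mono i<j eq))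
  immaculate⇒ T (rows , first) {i} {j} (i<j , inj₂ ≡0) with ℕ.m≤n⇒m<n∨m≡n (row-mono i<j)
  ... | inj₂ eq = rows (ET.cellOf i) (ET.cellOf j) (cong suc eq) (s≤s (column-mono i<j eq))
  ... | inj₁ lt with t , rt , ct ← row-start j = along (ℕ.m≤n⇒m<n∨m≡n (subst (_≤ columnOf j) (sym ct) z≤n))
    where
    i<t : (ET.labels T ⟨$⟩ʳ i) Fin.< (ET.labels T ⟨$⟩ʳ t)
    i<t = first (ET.cellOf i) (ET.cellOf t) (cong suc ≡0) (cong suc ct)
      (s≤s (subst (rowOf i <_) (sym rt) lt))
    along : columnOf t < columnOf j ⊎ columnOf t ≡ columnOf j → (ET.labels T ⟨$⟩ʳ i) Fin.< (ET.labels T ⟨$⟩ʳ j)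
    along (inj₁ lt′) = ℕ.<-trans i<t (rows (ET.cellOf t) (ET.cellOf j) (cong suc rt) (s≤s lt′))
    along (inj₂ eq) = subst (λ x → (ET.labels T ⟨$⟩ʳ i) Fin.< (ET.labels T ⟨$⟩ʳ x)) (coordinates-injective rt eq) i<t

  ⇒immaculate : (T : Filling (tcd α) (suc m)) → Immaculate (ET.labels T) → IsImmaculate α T
  ⇒immaculate T imm = rows , first
    where
    entries : ∀ b c → ET.index b <D ET.index c → entry T b Fin.< entry T c
    entries b c lt = subst₂ Fin._<_ (sym (ET.entry-labels T b)) (sym (ET.entry-labels T c)) (imm lt)
    row≡ : ∀ b → row (proj₁ b) ≡ suc (rowOf (ET.index b))
    row≡ b = cong row (sym (ET.box-index b))
    col≡ : ∀ b → col (proj₁ b) ≡ suc (columnOf (ET.index b))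
    col≡ b = cong col (sym (ET.box-index b))
    rows : ∀ b c → row (proj₁ b) ≡ row (proj₁ c) → col (proj₁ b) < col (proj₁ c) → entry T b Fin.< entry T c
    rows b c eq lt = entries b c (column-cancel eq′ (ℕ.s<s⁻¹ (subst₂ _<_ (col≡ b) (col≡ c) lt)) , inj₁ eq′)
      where eq′ = ℕ.suc-injective (trans (sym (row≡ b)) (trans eq (row≡ c)))
    first : ∀ b c → InFirstColumn (proj₁ b) → InFirstColumn (proj₁ c) → row (proj₁ b) < row (proj₁ c) →
            entry T b Fin.< entry T c
    first b c fb _ lt = entries b c
      ( row-< (ℕ.s<s⁻¹ (subst₂ _<_ (row≡ b) (row≡ c) lt))
      , inj₂ (ℕ.suc-injective (trans (sym (col≡ b)) fb)))

  -- Reading orders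

  RB-cancel : RB (tcd-box i) (tcd-box j) → (RB-filling ⟨$⟩ʳ i) Fin.< (RB-filling ⟨$⟩ʳ j)
  RB-cancel (inj₁ lt) = rank-mono RB-key (inj₁ (ℕ.s<s⁻¹ lt))
  RB-cancel (inj₂ (eq , lt)) = rank-mono RB-key
    (inj₂ (ℕ.suc-injective eq , column-cancel (sym (ℕ.suc-injective eq)) (ℕ.s<s⁻¹ lt)))

  RB-mono : (RB-filling ⟨$⟩ʳ i) Fin.< (RB-filling ⟨$⟩ʳ j) → RB (tcd-box i) (tcd-box j)
  RB-mono lt with rank-cancel RB-key lt
  ... | inj₁ row< = inj₁ (s≤s row<)
  ... | inj₂ (eq , j<i) = inj₂ (cong suc eq , s≤s (column-mono j<i (sym eq)))

  RB1-mono : (RB1-filling ⟨$⟩ʳ i) Fin.< (RB1-filling ⟨$⟩ʳ j) → RB1 (tcd-box i) (tcd-box j)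
  RB1-mono {i} {j} lt = go (columnOf i ℕ.≟ 0) (columnOf j ℕ.≟ 0) (rank-cancel RB1-key lt)
    where
    go : Dec (columnOf i ≡ 0) → Dec (columnOf j ≡ 0) → Rank._≺_ RB1-key i j → RB1 (tcd-box i) (tcd-box j)
    go (no c) (yes c′) _ = inj₂ (inj₁ (c ∘ ℕ.suc-injective , cong suc c′))
    go (yes c) (no c′) k = contradiction k (λ k → Rank.≺-irrefl RB1-key
      (Rank.≺-trans RB1-key k (inj₁ (RB1-other-first c′ c))))
    go (no c) (no c′) (inj₁ l) = inj₁ (c ∘ ℕ.suc-injective , c′ ∘ ℕ.suc-injective ,
      inj₁ (s≤s (subst₂ _<_ (RB1-key-other c) (RB1-key-other c′) l)))
    go (no c) (no c′) (inj₂ (eq , j<i)) = inj₁ (c ∘ ℕ.suc-injective , c′ ∘ ℕ.suc-injective ,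
      inj₂ (cong suc eq′ , s≤s (column-mono j<i (sym eq′))))
      where eq′ = trans (sym (RB1-key-other c)) (trans eq (RB1-key-other c′))
    go (yes c) (yes c′) (inj₁ l) = inj₂ (inj₂ (cong suc c , cong suc c′ ,
      s≤s (ℕ.+-cancelˡ-< (ℓ α) _ _ (subst₂ _<_ (RB1-key-first c) (RB1-key-first c′) l))))
    go (yes c) (yes c′) (inj₂ (eq , j<i)) = contradiction c (later-column j<i (sym (ℕ.+-cancelˡ-≡ (ℓ α) _ _
      (trans (sym (RB1-key-first c)) (trans eq (RB1-key-first c′))))))

  -- The columns of `𝒟 α ^x` read downwards are the rows of `tcd α` read left to right, so `TL` is
  -- the numbering itself and the word of a filling is its `labels`.
  TL-cancel : TL (EX.box i) (EX.box j) → i Fin.< j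
  TL-cancel (inj₁ lt) = row-< (ℕ.s<s⁻¹ lt)
  TL-cancel {i} {j} (inj₂ (eq , lt)) with Fin.<-cmp i j
  ... | tri< i<j _ _ = i<j
  ... | tri≈ _ refl _ = contradiction lt (ℕ.<-irrefl refl)
  ... | tri> _ _ j<i = contradiction (ℕ.∸-cancelʳ-< {𝒟-rowOf j} {𝒟-rowOf i} {suc (height (𝒟 α))} lt)
        (ℕ.<-asym (𝒟-row-same j<i (sym (ℕ.suc-injective eq))))

  TL-mono : i Fin.< j → TL (EX.box i) (EX.box j)
  TL-mono {i} {j} i<j with ℕ.m≤n⇒m<n∨m≡n (row-mono i<j)
  ... | inj₁ lt = inj₁ (s≤s lt)
  ... | inj₂ eq = inj₂ (cong suc eq , ℕ.∸-monoʳ-< (𝒟-row-same i<j eq)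
        (ℕ.m≤n⇒m≤1+n (row≤height (𝒟 α) (ED.box∈ j))))

  LB-mono : i Fin.< j → LB (tcd-box i) (tcd-box j)
  LB-mono i<j with ℕ.m≤n⇒m<n∨m≡n (row-mono i<j)
  ... | inj₁ lt = inj₁ (s≤s lt)
  ... | inj₂ eq = inj₂ (cong suc eq , s≤s (column-mono i<j eq))

  top-mono : (top ⟨$⟩ʳ i) Fin.< (top ⟨$⟩ʳ j) → FirstColumnThenLT (tcd-box i) (tcd-box j)
  top-mono {i} {j} lt = go (columnOf i ℕ.≟ 0) (columnOf j ℕ.≟ 0) (ℕ.<-cmp (rowOf i) (rowOf j)) (Fin.<-cmp i j)
    where
    i≢j : i ≢ j
    i≢j eq = ℕ.<⇒≢ lt (cong (λ x → toℕ (top ⟨$⟩ʳ x)) eq)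
    go : Dec (columnOf i ≡ 0) → Dec (columnOf j ≡ 0) → Tri (rowOf i < rowOf j) (rowOf i ≡ rowOf j) (rowOf j < rowOf i) →
         Tri (i Fin.< j) (i ≡ j) (j Fin.< i) → FirstColumnThenLT (tcd-box i) (tcd-box j)
    go _ _ _ (tri≈ _ eq _) = contradiction eq i≢j
    go (yes c) (no c′) _ _ = inj₂ (inj₁ (cong suc c , c′ ∘ ℕ.suc-injective))
    go (no c) (yes c′) _ _ = contradiction lt (ℕ.<-asym (top-first-other c′ c))
    go (yes c) (yes c′) (tri< l _ _) _ = inj₁ (cong suc c , cong suc c′ , s≤s l)
    go (yes c) (yes c′) (tri> _ _ g) _ = contradiction lt (ℕ.<-asym (top-first-first g c′ c))
    go (yes c) (yes c′) (tri≈ _ eq _) (tri< l _ _) = contradiction c′ (later-column l eq)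
    go (yes c) (yes c′) (tri≈ _ eq _) (tri> _ _ g) = contradiction c (later-column g (sym eq))
    go (no c) (no c′) (tri< l _ _) _ = contradiction lt (ℕ.<-asym (top-cross l c))
    go (no c) (no c′) (tri> _ _ g) _ = inj₂ (inj₂ (c ∘ ℕ.suc-injective , c′ ∘ ℕ.suc-injective , inj₁ (s≤s g)))
    go (no c) (no c′) (tri≈ _ eq _) (tri< l _ _) = inj₂ (inj₂ (c ∘ ℕ.suc-injective , c′ ∘ ℕ.suc-injective ,
      inj₂ (cong suc eq , s≤s (column-mono l eq))))
    go (no c) (no c′) (tri≈ _ eq _) (tri> _ _ g) = contradiction lt (ℕ.<-asym (top-same (sym eq) g c′ c))

  -- The words of the class

  Words-cong : {F G : Permutation′ (suc m)} → F ≈ G → Words F ≐ Words G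
  Words-cong {F} {G} eq =
    (λ {σ} → Immaculate-resp {T = σ · F} {σ · G} (λ k → cong (σ ⟨$⟩ʳ_) (eq k))) ,
    (λ {σ} → Immaculate-resp {T = σ · G} {σ · F} (λ k → cong (σ ⟨$⟩ʳ_) (sym (eq k))))

  ≐-trans : (A B C : Pred (Permutation′ (suc m)) 0ℓ) → A ≐ B → B ≐ C → A ≐ C
  ≐-trans A B C (f , f′) (g , g′) = (λ {σ} a → g {σ} (f {σ} a)) , (λ {σ} c → f′ {σ} (g′ {σ} c))

  ≐-sym : {A B : Pred (Permutation′ (suc m)) 0ℓ} → A ≐ B → B ≐ A
  ≐-sym (f , f′) = (λ {σ} → f′ {σ}) , (λ {σ} → f {σ})

  -- Reflecting twice restores the order of 𝒟, so `P (reflect T)` is that order with each cell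
  -- renamed by its entry in `T`.
  Words≐ΣL : (T : Filling (𝒟 α ^x) (suc m)) → Words (EX.labels T) ≐ ΣL (P (reflect T))
  Words≐ΣL T = (λ {σ} → to σ) , (λ {σ} → from σ)
    where
    F = EX.labels T
    flip² = flipBox (height (𝒟 α ^x))
    place : ∀ v → position (reflect T) v ≡ EXX.box (F ⟨$⟩ˡ v)
    place v = cong flip² (EX.box-labels T v)
    un : ∀ {i j} → EXX.box i ≤ᵇ EXX.box j → 𝒟-box i ≤ᵇ 𝒟-box j
    un {i} {j} le with flip-≤ᵇ⁻ (𝒟 α ^x) (EX.box∈ i) (EX.box∈ j) le
    ... | cols , rows = cols , ℕ.≮⇒≥ λ lt → ℕ.<⇒≱ (ℕ.∸-monoʳ-< lt (ℕ.m≤n⇒m≤1+n (row≤height (𝒟 α) (ED.box∈ i)))) rows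
    re : ∀ {i j} → 𝒟-box i ≤ᵇ 𝒟-box j → EXX.box i ≤ᵇ EXX.box j
    re (cols , rows) = flip-≤ᵇ⁺ (𝒟 α ^x) cols (ℕ.∸-monoʳ-≤ (suc (height (𝒟 α))) rows)
    to : ∀ σ → σ ∈ Words F → σ ∈ ΣL (P (reflect T))
    to σ imm u v le = subst₂ (λ x y → (σ ⟨$⟩ʳ x) Fin.≤ (σ ⟨$⟩ʳ y)) (inverseʳ F) (inverseʳ F)
        (weaken (≤D⇒ (un (subst₂ _≤ᵇ_ (place u) (place v) le))))
      where
      weaken : F ⟨$⟩ˡ u ≡ F ⟨$⟩ˡ v ⊎ (F ⟨$⟩ˡ u) <D (F ⟨$⟩ˡ v) →
               (σ ⟨$⟩ʳ (F ⟨$⟩ʳ (F ⟨$⟩ˡ u))) Fin.≤ (σ ⟨$⟩ʳ (F ⟨$⟩ʳ (F ⟨$⟩ˡ v)))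
      weaken (inj₁ eq) = ℕ.≤-reflexive (cong (λ x → toℕ (σ ⟨$⟩ʳ (F ⟨$⟩ʳ x))) eq)
      weaken (inj₂ lt) = ℕ.<⇒≤ (imm lt)
    from : ∀ σ → σ ∈ ΣL (P (reflect T)) → σ ∈ Words F
    from σ ext {i} {j} lt = Fin.≤∧≢⇒< (ext (F ⟨$⟩ʳ i) (F ⟨$⟩ʳ j)
        (subst₂ _≤ᵇ_ (sym (place′ i)) (sym (place′ j)) (re (⇒≤D lt))))
      (λ eq → ℕ.<⇒≢ (proj₁ lt) (cong toℕ (to-injective F (to-injective σ eq))))
      where
      place′ : ∀ i → position (reflect T) (F ⟨$⟩ʳ i) ≡ EXX.box i
      place′ i = trans (place (F ⟨$⟩ʳ i)) (cong EXX.box (inverseˡ F))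

  readingWords≐ : readingWords α ≐ Words RB-filling
  readingWords≐ = (λ {σ} → to σ) , (λ {σ} → from σ)
    where
    to : ∀ σ → σ ∈ readingWords α → σ ∈ Words RB-filling
    to σ ((T , imm) , reads) = Immaculate-resp {T = ET.labels T} {σ · RB-filling}
      (λ k → sym (ET.reads⇒ RB RB-filling RB-cancel T σ reads k)) (immaculate⇒ T imm)
    from : ∀ σ → σ ∈ Words RB-filling → σ ∈ readingWords α
    from σ imm = (T , ⇒immaculate T (Immaculate-resp {T = σ · RB-filling} {ET.labels T}
        (λ k → sym (ET.labels-fill (σ · RB-filling) k)) imm)) ,
      ET.⇒reads RB RB-filling RB-mono T σ (λ k → sym (ET.labels-fill (σ · RB-filling) k))
      where T = ET.fill (σ · RB-filling)

  -- The class and the standard fillings of the reflected diagram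

  open Class (readingWords α) readingWords≐

  tableau : (T : Permutation′ (suc m)) → Immaculate T → SIT α
  tableau T imm = ET.fill T , ⇒immaculate (ET.fill T)
    (Immaculate-resp {T = T} {ET.labels (ET.fill T)} (λ k → sym (ET.labels-fill T k)) imm)

  -- The filling of an interval of the class is read off its least element.
  toST : (I : Interval m) → I ∈ C𝒱 α → ST (𝒟 α ^x) (suc m)
  toST I iso = EX.fill (flip (lo I)) , ⇒standard (EX.fill (flip (lo I)))
    λ {i} {j} lt → subst₂ Fin._<_ (sym (EX.labels-fill (flip (lo I)) i)) (sym (EX.labels-fill (flip (lo I)) j))
      (class-standard I iso lt)

  fromST : ST (𝒟 α ^x) (suc m) → Interval m
  fromST (T , std) = interval (EX.labels T) (standard⇒ T std)

  fromST∈ : (T : ST (𝒟 α ^x) (suc m)) → fromST T ∈ C𝒱 α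
  fromST∈ (T , std) = interval∈class (EX.labels T) (standard⇒ T std)

  toST-words : (I : Interval m) (iso : I ∈ C𝒱 α) → ⟦ I ⟧ ≐ ΣL (P (reflect (proj₁ (toST I iso))))
  toST-words I iso = ≐-trans ⟦ I ⟧ (Words (flip (lo I))) (ΣL (P (reflect T))) (class-words I iso)
    (≐-trans (Words (flip (lo I))) (Words (EX.labels T)) (ΣL (P (reflect T)))
      (Words-cong {flip (lo I)} {EX.labels T} (λ k → sym (EX.labels-fill (flip (lo I)) k))) (Words≐ΣL T))
    where T = EX.fill (flip (lo I))

  fromST-words : (T : ST (𝒟 α ^x) (suc m)) → ⟦ fromST T ⟧ ≐ ΣL (P (reflect (proj₁ T)))
  fromST-words (T , std) = ≐-trans ⟦ fromST (T , std) ⟧ (Words (EX.labels T)) (ΣL (P (reflect T)))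
    (interval≐ (EX.labels T) (standard⇒ T std)) (Words≐ΣL T)

  minimum : Σ (Interval m) λ I → IsMin (C𝒱 α) I × Is-w₀⟨ ∁ (setOf α) ⟩ (lo I)
            × (Σ (SIT α) λ T → Is-𝒯′ α T × Reads RB (proj₁ T) (hi I))
  minimum = interval RB-filling RB-standard ,
    (interval∈class RB-filling RB-standard , RB-least) ,
    IsLongest-flip {σ = RB-filling} (rank-longest RB-key row-mono (∁ (setOf α)) tie untie) ,
    tableau top top-immaculate , filled ,
    ET.⇒reads RB RB-filling RB-mono (ET.fill top) (top · flip RB-filling)
      (λ k → trans (cong (top ⟨$⟩ʳ_) (inverseˡ RB-filling)) (sym (ET.labels-fill top k)))
    where
    tie : ∀ {e} → e ∈ ∁ (setOf α) → rowOf (lower e) ≡ rowOf (upper e)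
    tie {e} e∉ with rowOf (lower e) ℕ.≟ rowOf (upper e)
    ... | yes eq = eq
    ... | no ≢ = contradiction (jump⇒ (cong suc (sym (toℕ-inject₁ e))) ≢) e∉
    untie : ∀ {e} → rowOf (lower e) ≡ rowOf (upper e) → e ∈ ∁ (setOf α)
    untie {e} eq e∈ = ⇒jump (cong suc (sym (toℕ-inject₁ e))) e∈ eq
    filled : FilledAlong FirstColumnThenLT (ET.fill top)
    filled u v u<v = top-mono (subst₂ Fin._<_ (sym (inverseʳ top)) (sym (inverseʳ top)) u<v)

  maximum : Σ (Interval m) λ I → IsMax (C𝒱 α) I
            × (Σ (SIT α) λ T → Is-𝒯 α T × Reads RB1 (proj₁ T) (lo I))
            × Is-w₁⟨ upToSet (suc m ∸ ℓ α) ⟩ (hi I)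
  maximum = interval RB1-filling RB1-standard ,
    (interval∈class RB1-filling RB1-standard , RB1-greatest) ,
    (tableau id id-immaculate , (λ u v u<v → LB-mono u<v) ,
      ET.⇒reads RB1 RB1-filling RB1-mono (ET.fill id) (flip RB1-filling)
        (λ k → trans (inverseˡ RB1-filling) (sym (ET.labels-fill id k)))) ,
    -- Indices count from 0, so lying outside `upToSet k` means `k ≤ toℕ i`.
    top-RB1-longest (others-count α) (∁ (upToSet (suc m ∸ ℓ α))) ℕ.≮⇒≥ ℕ.≤⇒≯

  -- Members of the class are compared as sets while `toST` uses an endpoint; this makes it well
  -- defined.
  lo-unique : (I J : Interval m) → ⟦ I ⟧ ≐ ⟦ J ⟧ → lo I ≈ lo J
  lo-unique I J (f , g) = ⊑-antisym (lo I) (lo J)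
    (⪯L⇒⊑ (proj₁ (g {lo J} (done (λ _ → refl) , lo⪯hi J))))
    (⪯L⇒⊑ (proj₁ (f {lo I} (done (λ _ → refl) , lo⪯hi I))))

  classIso : IsOrderIsomorphism {A = Σ (Interval m) (C𝒱 α)} {B = ST (𝒟 α ^x) (suc m)}
    (λ I J → ⟦ proj₁ I ⟧ ≐ ⟦ proj₁ J ⟧) _≈ST_ (λ I J → proj₁ I ⪯ proj₁ J) _⊴_ (λ (I , iso) → toST I iso)
  classIso = record
    { isOrderMonomorphism = record
      { isOrderHomomorphism = record
        { cong = λ { {I , _} {J , _} eq c → flip-cong {σ = lo I} {lo J} (lo-unique I J eq) (EX.index c) }
        ; mono = λ { {I , _} {J , _} le → flip (lo I) , flip (lo J) , reads I , reads J ,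
                       ⊑⇒⪯L (flip (lo I)) (flip (lo J)) (⪯R⇒⊑ le) }
        }
      ; injective = λ { {I , iso} {J , iso′} eq → ≐-trans ⟦ I ⟧ (Words (flip (lo I))) ⟦ J ⟧ (class-words I iso)
          (≐-trans (Words (flip (lo I))) (Words (flip (lo J))) ⟦ J ⟧
            (Words-cong {flip (lo I)} {flip (lo J)} (fillings≈ I J eq)) (≐-sym {⟦ J ⟧} {Words (flip (lo J))} (class-words J iso′))) }
      -- The words witnessing `⊴` are arbitrary; `word` identifies them with the inverses of the
      -- least elements.
      ; cancel = λ { {I , iso} {J , iso′} (σ , τ , readsσ , readsτ , le) → ⊑⇒⪯R (lo I) (lo J)
          (λ inv → ≈⇒⊑ {σ = τ} {flip (lo J)} (word J τ readsτ)
            (⪯L⇒⊑ le (≈⇒⊑ {σ = flip (lo I)} {σ} (≈-sym {σ = σ} {flip (lo I)} (word I σ readsσ)) inv))) }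
      }
    ; surjective = λ T → (fromST T , fromST∈ T) , λ { {I , _} eq c →
        trans (flip-cong {σ = lo I} {lo (fromST T)} (lo-unique I (fromST T) eq) (EX.index c))
          (sym (EX.entry-labels (proj₁ T) c)) }
    }
    where
    reads : ∀ I → Reads TL (EX.fill (flip (lo I))) (flip (lo I))
    reads I = EX.⇒reads TL id TL-mono (EX.fill (flip (lo I))) (flip (lo I))
      (λ k → sym (EX.labels-fill (flip (lo I)) k))
    word : ∀ I σ → Reads TL (EX.fill (flip (lo I))) σ → σ ≈ flip (lo I)
    word I σ reads k = trans (EX.reads⇒ TL id TL-cancel (EX.fill (flip (lo I))) σ reads k)
      (EX.labels-fill (flip (lo I)) k)
    fillings≈ : ∀ I J → (∀ c → entry (EX.fill (flip (lo I))) c ≡ entry (EX.fill (flip (lo J))) c) → flip (lo I) ≈ flip (lo J)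
    fillings≈ I J eq i = trans (sym (EX.labels-fill (flip (lo I)) i)) (trans (eq (EX.cellOf i)) (EX.labels-fill (flip (lo J)) i))

proposition5p4 : ∀ {m : ℕ} (α : Composition (suc m)) →
    ( ( (∀ (I : Interval m) → I ∈ C𝒱 α →
    Σ (ST (𝒟 α ^x) (suc m)) λ T → ⟦ I ⟧ ≐ ΣL (P (reflect (proj₁ T))))
    × (∀ (T : ST (𝒟 α ^x) (suc m)) →
    Σ (Interval m) λ I → I ∈ C𝒱 α × ⟦ I ⟧ ≐ ΣL (P (reflect (proj₁ T)))) )
    × (Σ (Interval m) λ I →
    IsMin (C𝒱 α) I
    × Is-w₀⟨ ∁ (setOf α) ⟩ (lo I)
    × (Σ (SIT α) λ T → Is-𝒯′ α T × Reads RB (proj₁ T) (hi I)))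
    × (Σ (Interval m) λ I →
    IsMax (C𝒱 α) I
    × (Σ (SIT α) λ T → Is-𝒯 α T × Reads RB1 (proj₁ T) (lo I))
    × Is-w₁⟨ upToSet (suc m ∸ ℓ α) ⟩ (hi I)) )
    × (Σ (Σ (Interval m) (C𝒱 α) → ST (𝒟 α ^x) (suc m)) λ f →
    IsOrderIsomorphism
    (λ I J → ⟦ proj₁ I ⟧ ≐ ⟦ proj₁ J ⟧) _≈ST_
    (λ I J → proj₁ I ⪯ proj₁ J) _⊴_
    f)
proposition5p4 α =
  ( ((λ I iso → toST I iso , toST-words I iso) , (λ T → fromST T , fromST∈ T , fromST-words T))
  , minimum , maximum )
  , (λ (I , iso) → toST I iso) , classIso
  where open ClassOf α
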